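{- Let $k,a,b$ be positive integers with $a\leqslant b$ coprime, let $\chi=(k-1)+a/b$, and let $\mu\in(0,1]$. There exists $\rho'_0>0$ such that for every $\rho'\in(0,\rho'_0]$ there is $\rho_0>0$ such that for every $\rho\in(0,\rho_0]$ there is $n_0$ such that for all $n\geqslant n_0$ and all $\ell,t\in\mathbb{N}$: if $G$ is a $\mu$-robust $(\chi,\rho;t,\ell)$-tiling framework on $n$ vertices, then $G$ contains a $B_\chi$-tiling covering at least $(1-\rho')n$ vertices.
   Context: Here $B_\chi$ denotes the complete $k$-partite graph with one part of size $a$ and $k-1$ parts of size $b$. A $B_\chi$-tiling in $G$ is a collection of vertex-disjoint copies of $B_\chi$ in $G$. A fractional $F$-tiling of $G$ is $\omega:\mathrm{Hom}(F;G)\to[0,1]$ with $\sum_\theta\omega(\theta)|\theta^{ -1}(v)|\leqslant1$ for all $v$; weight $v(F)\sum_\theta\omega(\theta)$; $(1-\rho)$-perfect if weight $\geqslant(1-\rho)v(G)$. $K_k(G)$ is the $k$-graph of $k$-cliques of $G$. Tight components of a $k$-graph $J$: subhypergraphs whose edge sets are components of the graph on $E(J)$ with $e\sim f$ iff $|e\cap f|=k-1$. Loose components: unions of tight components forming components of the graph on tight components where two are adjacent iff their vertex sets meet. $J$ is $(t,\ell)$-connected if some vertex-spanning subgraph has at most $t$ tight and at most $\ell$ loose components. $v$ and edge $f\not\ni v$ are linked if some edge $e\ni v$ has $|e\cap f|=k-1$; $J$ is linked if every vertex is linked to an edge. $G$ is a $(\chi,\rho;t,\ell)$-tiling framework if it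 has a $(1-\rho)$-perfect fractional $B_\chi$-tiling and $K_{\lceil\chi\rceil}(G)$ is $(t,\ell)$-connected and linked. An $(\varepsilon,d)$-approximation of $G$ is a subgraph $G'$ with $\deg_{G'}(v)\geqslant\deg_G(v)-d\,v(G)$ for $v\in V(G')$ and $v(G')\geqslant(1-\varepsilon)v(G)$; $G$ is a $\mu$-robust $(\chi,\rho;t,\ell)$-tiling framework if every $(\mu,\mu)$-approximation of $G$ is a $(\chi,\rho;t,\ell)$-tiling framework.
   Formalization: The parameters μ, ρ, ρ', the constants ρ₀ and ρ'₀, and the weights of the fractional tilings are taken to be rational instead of real. -}

module Defs where

open import Data.Nat as ℕ using (ℕ; zero; suc; _∸_)
open import Data.Integer using (+_)
open import Data.Rational as ℚ using (ℚ; 0ℚ; 1ℚ; _/_)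
open import Data.Bool using (Bool; true; false; not; _∧_; _∨_; if_then_else_)
open import Data.Fin using (Fin)
import Data.Fin as Fin
open import Data.Fin.Subset using (Subset; _∈_; _∉_; _∩_; ∣_∣)
open import Data.List using (List; []; _∷_; map; _++_; allFin; cartesianProduct; foldr; length; lookup)
open import Data.Bool.ListAction using (any)
open import Data.Product using (Σ; ∃; _×_; _,_; proj₁; proj₂)
open import Data.Sum using (_⊎_; inj₁; inj₂)
open import Data.List.Relation.Unary.All using (All)
open import Relation.Nullary.Decidable using (⌊_⌋)
open import Relation.Binary.PropositionalEquality using (_≡_; _≢_)
open import Relation.Binary.Construct.Closure.ReflexiveTransitive using (Star)
open import Function.Definitions using (Injective)

record Graph (n : ℕ) : Set where
  field
    adj   : Fin n → Fin n → Bool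
    sym   : ∀ u v → adj u v ≡ adj v u
    irref : ∀ v → adj v v ≡ false
open Graph public

countL : {A : Set} → (A → Bool) → List A → ℕ
countL p []       = 0
countL p (x ∷ xs) = if p x then suc (countL p xs) else countL p xs

countFin : {n : ℕ} → (Fin n → Bool) → ℕ
countFin {n} p = countL p (allFin n)

deg : {n : ℕ} → Graph n → Fin n → ℕ
deg G v = countFin (adj G v)

ℕ→ℚ : ℕ → ℚ
ℕ→ℚ m = + m / 1

sumℚ : List ℚ → ℚ
sumℚ = foldr ℚ._+_ 0ℚ

-- B_χ : complete k-partite graph, one part of size a, k-1 parts of size b.
-- Vertices: Fin a (the part of size a) ⊎ (Fin (k-1) × Fin b).

BV : (k a b : ℕ) → Set
BV k a b = Fin a ⊎ (Fin (k ∸ 1) × Fin b)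

BVlist : (k a b : ℕ) → List (BV k a b)
BVlist k a b = map inj₁ (allFin a) ++ map inj₂ (cartesianProduct (allFin (k ∸ 1)) (allFin b))

vB : (k a b : ℕ) → ℕ
vB k a b = a ℕ.+ (k ∸ 1) ℕ.* b

adjB : {k a b : ℕ} → BV k a b → BV k a b → Bool
adjB (inj₁ _)       (inj₁ _)       = false
adjB (inj₁ _)       (inj₂ _)       = true
adjB (inj₂ _)       (inj₁ _)       = true
adjB (inj₂ (i , _)) (inj₂ (j , _)) = not ⌊ i Fin.≟ j ⌋

record Hom (k a b : ℕ) {n : ℕ} (G : Graph n) : Set where
  field
    hmap : BV k a b → Fin n
    pres : ∀ x y → adjB {k} {a} {b} x y ≡ true → adj G (hmap x) (hmap y) ≡ true
open Hom public

preimage : {k a b n : ℕ} {G : Graph n} → Hom k a b G → Fin n → ℕ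
preimage {k} {a} {b} θ v = countL (λ x → ⌊ hmap θ x Fin.≟ v ⌋) (BVlist k a b)

-- Fractional B_χ-tilings (finitely supported weight functions, given as a
-- list of (homomorphism, weight) pairs).

IsFracTiling : (k a b : ℕ) {n : ℕ} (G : Graph n) → List (Hom k a b G × ℚ) → Set
IsFracTiling k a b {n} G L =
  All (λ p → (0ℚ ℚ.≤ proj₂ p) × (proj₂ p ℚ.≤ 1ℚ)) L ×
  (∀ (v : Fin n) → sumℚ (map (λ p → proj₂ p ℚ.* ℕ→ℚ (preimage (proj₁ p) v)) L) ℚ.≤ 1ℚ)

fracWeight : (k a b : ℕ) {n : ℕ} (G : Graph n) → List (Hom k a b G × ℚ) → ℚ
fracWeight k a b G L = ℕ→ℚ (vB k a b) ℚ.* sumℚ (map proj₂ L)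

PerfectFracTiling : (k a b : ℕ) (ρ : ℚ) {n : ℕ} (G : Graph n) → Set
PerfectFracTiling k a b ρ {n} G =
  Σ (List (Hom k a b G × ℚ)) λ L →
    IsFracTiling k a b G L × ((1ℚ ℚ.- ρ) ℚ.* ℕ→ℚ n ℚ.≤ fracWeight k a b G L)

KEdge : (k : ℕ) {n : ℕ} → Graph n → Subset n → Set
KEdge k G e = (∣ e ∣ ≡ k) × (∀ x y → x ∈ e → y ∈ e → x ≢ y → adj G x y ≡ true)

-- A subgraph J' of K_k(G) is given by a predicate on edges.
-- Tight adjacency in J': |e ∩ f| = k - 1.
TightAdj : (k : ℕ) {n : ℕ} → (Subset n → Set) → Subset n → Subset n → Set
TightAdj k E e f = E e × E f × (∣ e ∩ f ∣ ≡ k ∸ 1)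

LooseAdj : (k : ℕ) {n : ℕ} → (Subset n → Set) → Subset n → Subset n → Set
LooseAdj k E e f = E e × E f × ((∣ e ∩ f ∣ ≡ k ∸ 1) ⊎ ∃ λ v → v ∈ e × v ∈ f)

AtMostComponents : {n : ℕ} → ℕ → (Subset n → Set) → (Subset n → Subset n → Set) → Set
AtMostComponents {n} t E R =
  Σ (Subset n → Fin t) λ c → ∀ e f → E e → E f → c e ≡ c f → Star R e f

TLConnected : (k t ℓ : ℕ) {n : ℕ} → Graph n → Set₁
TLConnected k t ℓ {n} G =
  Σ (Subset n → Set) λ E →
    (∀ e → E e → KEdge k G e) ×
    (∀ (v : Fin n) → ∃ λ e → E e × v ∈ e) ×
    AtMostComponents t E (TightAdj k E) ×
    AtMostComponents ℓ E (LooseAdj k E)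

Linked : (k : ℕ) {n : ℕ} → Graph n → Set
Linked k {n} G =
  ∀ (v : Fin n) → ∃ λ f → KEdge k G f × v ∉ f ×
    ∃ λ e → KEdge k G e × v ∈ e × (∣ e ∩ f ∣ ≡ k ∸ 1)

-- Tiling frameworks.  χ = (k-1) + a/b with 1 ≤ a ≤ b, so ⌈χ⌉ = k.

TilingFramework : (k a b : ℕ) (ρ : ℚ) (t ℓ : ℕ) {n : ℕ} → Graph n → Set₁
TilingFramework k a b ρ t ℓ G =
  PerfectFracTiling k a b ρ G × TLConnected k t ℓ G × Linked k G

record Approximation {n : ℕ} (G : Graph n) (ε d : ℚ) : Set where
  field
    m      : ℕ
    H      : Graph m
    ι      : Fin m → Fin n
    ι-inj  : Injective _≡_ _≡_ ι
    sub    : ∀ u v → adj H u v ≡ true → adj G (ι u) (ι v) ≡ true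
    degOK  : ∀ v → ℕ→ℚ (deg G (ι v)) ℚ.- d ℚ.* ℕ→ℚ n ℚ.≤ ℕ→ℚ (deg H v)
    sizeOK : (1ℚ ℚ.- ε) ℚ.* ℕ→ℚ n ℚ.≤ ℕ→ℚ m
open Approximation public

RobustTilingFramework : (μ : ℚ) (k a b : ℕ) (ρ : ℚ) (t ℓ : ℕ) {n : ℕ} → Graph n → Set₁
RobustTilingFramework μ k a b ρ t ℓ G =
  ∀ (A : Approximation G μ μ) → TilingFramework k a b ρ t ℓ (H A)

record Copy (k a b : ℕ) {n : ℕ} (G : Graph n) : Set where
  field
    hom : Hom k a b G
    inj : Injective _≡_ _≡_ (hmap hom)
open Copy public

IsTiling : (k a b : ℕ) {n : ℕ} (G : Graph n) → List (Copy k a b G) → Set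
IsTiling k a b G L =
  ∀ (i j : Fin (length L)) → i ≢ j → ∀ x y →
    hmap (hom (lookup L i)) x ≢ hmap (hom (lookup L j)) y

covers : {k a b n : ℕ} {G : Graph n} → List (Copy k a b G) → Fin n → Bool
covers {k} {a} {b} L v =
  any (λ c → any (λ x → ⌊ hmap (hom c) x Fin.≟ v ⌋) (BVlist k a b)) L

coveredCount : {k a b n : ℕ} {G : Graph n} → List (Copy k a b G) → ℕ
coveredCount L = countFin (covers L)

{-# OPTIONS --safe #-}
-- Call a pair of vertex classes irregular if it contains a rectangle X × Y of non-negligible area with
-- fewer than |X||Y|/D edges. Removing one such rectangle from every irregular pair at once, and
-- refining the partition accordingly, costs few edges because the rectangles are sparse and disjoint;
-- if the irregular pairs have total area at least n²/E, the removed area grows by n²/E². So boundedly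
-- many rounds make almost all remaining pairs lower-regular, with the removed area as the only
-- potential. Deleting the edges outside lower-regular pairs gives an approximation H of G. A
-- fractional tiling of H, grouped by the classes into which a homomorphism sends the vertices of B and
-- rounded down, prescribes how many copies of each type to place, and these are embedded greedily one
-- after another since a fixed fraction of every class always stays unused.
module Submission where

open import Defs hiding (sym; m)
open import Data.Bool using (Bool; true; false; not; _∧_; _∨_)
open import Data.Bool.ListAction using (any)
open import Data.Bool.Properties using (∧-comm; ∨-comm)
open import Data.Empty using (⊥-elim)
open import Data.Fin using (Fin; zero; suc; combine; remQuot; funToFin; finToFun; splitAt; join)
import Data.Fin as Fin
open import Data.Fin.Properties using (remQuot-combine; finToFun-funToFin; splitAt-join)
open import Data.Fin.Subset using (Subset)
open import Data.Fin.Subset.Properties using (anySubset?)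
open import Data.List using (List; []; _∷_; map; _++_; allFin; tabulate; length; lookup; replicate; cartesianProduct)
open import Data.List.Membership.Propositional using (_∈_)
open import Data.List.Membership.Propositional.Properties using (∈-map⁺; ∈-map⁻; ∈-++⁺ˡ; ∈-++⁺ʳ; ∈-cartesianProduct⁺; ∈-allFin)
open import Data.List.Properties using (length-tabulate; length-map; length-++; map-cong)
open import Data.List.Relation.Unary.All as All using (All; []; _∷_)
open import Data.List.Relation.Unary.All.Properties using (++⁺; replicate⁺)
open import Data.List.Relation.Unary.AllPairs using ([]; _∷_)
open import Data.List.Relation.Unary.Any using (here; there)
open import Data.List.Relation.Unary.Unique.Propositional using (Unique)
import Data.List.Relation.Unary.Unique.Propositional.Properties as Unique
open import Data.Nat using (ℕ; zero; suc; z≤n; s≤s; NonZero; >-nonZero)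
open import Data.Nat.Tactic.RingSolver using (solve-∀)
open import Data.Product as Product using (Σ; ∃; ∃₂; _×_; _,_; proj₁; proj₂)
open import Data.Sum as Sum using (inj₁; inj₂)
open import Data.Sum.Properties using (inj₁-injective; inj₂-injective)
import Data.Vec as Vec
open import Data.Vec.Properties using (lookup∘tabulate)
open import Function using (_∘_; id; const)
open import Function.Definitions using (Injective)
open import Relation.Binary.PropositionalEquality using (_≡_; _≢_; refl; sym; trans; cong; cong₂; subst; subst₂)
open import Relation.Nullary using (Dec; yes; no)
open import Relation.Nullary.Decidable using (⌊_⌋; isYes≗does)

-- All estimates are cleared of denominators and live in ℕ; ℚ enters only where a hypothesis is read
-- or the conclusion returned. Write Z for `suc z` and h for the order of B. The constants depend on
-- each other in this order. Z is at least 1/μ and (3 + h)/ρ'. D = 8 Z² caps the edges lost in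
-- cleaning. K = Z (4 D)^h bounds how far a candidate set shrinks below its class while one copy is
-- embedded: it starts at a free fraction 1/Z and goes through h steps costing 4 D each. E > 2 K² h
-- makes the regularity error harmless for sets of relative size 1/K. M bounds the number of
-- classes, and n₀ comes last. The partition is never made equitable: regularity is measured against
-- the product of the two class sizes, and only classes with at most 2 D K vertices are given up, a
-- bounded number of vertices in all. Rounding is cheap because there are at most M^h types, so it
-- loses a bounded number of copies. The factor 3 + h tallies the losses in units of n/Z: the defect
-- ρ (1), the bad vertices (h), the free fraction (1) and the rounding (1).

-- Finite sums, indicators and double sums over vertices.

module FiniteSums where

  open import Data.Nat using (_+_; _*_; _≤_; _<_; _<?_)
  open import Data.Nat.Properties

  ⟦_⟧ : Bool → ℕ
  ⟦ true ⟧  = 1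
  ⟦ false ⟧ = 0

  ∑ : {A : Set} → List A → (A → ℕ) → ℕ
  ∑ []       f = 0
  ∑ (x ∷ xs) f = f x + ∑ xs f

  ∑-cong : {A : Set} (xs : List A) {f g : A → ℕ} → (∀ x → f x ≡ g x) → ∑ xs f ≡ ∑ xs g
  ∑-cong []       f≡g = refl
  ∑-cong (x ∷ xs) f≡g = cong₂ _+_ (f≡g x) (∑-cong xs f≡g)

  ∑-mono : {A : Set} (xs : List A) {f g : A → ℕ} → (∀ x → f x ≤ g x) → ∑ xs f ≤ ∑ xs g
  ∑-mono []       f≤g = z≤n
  ∑-mono (x ∷ xs) f≤g = +-mono-≤ (f≤g x) (∑-mono xs f≤g)

  ∑-zero : {A : Set} (xs : List A) → ∑ xs (λ _ → 0) ≡ 0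
  ∑-zero []       = refl
  ∑-zero (x ∷ xs) = ∑-zero xs

  +-interchange : ∀ a b c d → (a + b) + (c + d) ≡ (a + c) + (b + d)
  +-interchange = solve-∀

  ∑-+ : {A : Set} (xs : List A) (f g : A → ℕ) → ∑ xs (λ x → f x + g x) ≡ ∑ xs f + ∑ xs g
  ∑-+ []       f g = refl
  ∑-+ (x ∷ xs) f g = trans (cong (f x + g x +_) (∑-+ xs f g)) (+-interchange (f x) (g x) _ _)

  ∑-*ˡ : {A : Set} (c : ℕ) (xs : List A) (f : A → ℕ) → ∑ xs (λ x → c * f x) ≡ c * ∑ xs f
  ∑-*ˡ c []       f = sym (*-zeroʳ c)
  ∑-*ˡ c (x ∷ xs) f = trans (cong (c * f x +_) (∑-*ˡ c xs f)) (sym (*-distribˡ-+ c (f x) _))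

  ∑-*ʳ : {A : Set} (c : ℕ) (xs : List A) (f : A → ℕ) → ∑ xs (λ x → f x * c) ≡ ∑ xs f * c
  ∑-*ʳ c xs f = trans (∑-cong xs (λ x → *-comm (f x) c)) (trans (∑-*ˡ c xs f) (*-comm c _))

  ∑-const : {A : Set} (xs : List A) (c : ℕ) → ∑ xs (λ _ → c) ≡ length xs * c
  ∑-const []       c = refl
  ∑-const (x ∷ xs) c = cong (c +_) (∑-const xs c)

  ∑-swap : {A B : Set} (xs : List A) (ys : List B) (f : A → B → ℕ) →
           ∑ xs (λ x → ∑ ys (f x)) ≡ ∑ ys (λ y → ∑ xs (λ x → f x y))
  ∑-swap []       ys f = sym (∑-zero ys)
  ∑-swap (x ∷ xs) ys f = trans (cong (∑ ys (f x) +_) (∑-swap xs ys f)) (sym (∑-+ ys (f x) _))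

  ∑-tabulate : {A : Set} {n : ℕ} (g : Fin n → A) (f : A → ℕ) → ∑ (tabulate g) f ≡ ∑ (allFin n) (f ∘ g)
  ∑-tabulate {n = zero}  g f = refl
  ∑-tabulate {n = suc n} g f =
    cong (f (g zero) +_) (trans (∑-tabulate (g ∘ suc) f) (sym (∑-tabulate suc (f ∘ g))))

  ∑-++ : {A : Set} (xs ys : List A) (f : A → ℕ) → ∑ (xs ++ ys) f ≡ ∑ xs f + ∑ ys f
  ∑-++ []       ys f = refl
  ∑-++ (x ∷ xs) ys f = trans (cong (f x +_) (∑-++ xs ys f)) (sym (+-assoc (f x) _ _))

  ∑-suc : {n : ℕ} (f : Fin (suc n) → ℕ) → ∑ (allFin (suc n)) f ≡ f zero + ∑ (allFin n) (f ∘ suc)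
  ∑-suc f = cong (f zero +_) (∑-tabulate suc f)

  ∑-δ : {n : ℕ} (c : Fin n) (g : Fin n → ℕ) → ∑ (allFin n) (λ i → ⟦ ⌊ c Fin.≟ i ⌋ ⟧ * g i) ≡ g c
  ∑-δ {suc n} zero g =
    trans (∑-suc (λ i → ⟦ ⌊ zero Fin.≟ i ⌋ ⟧ * g i))
      (trans (cong₂ _+_ (+-identityʳ (g zero)) (∑-zero (allFin n))) (+-identityʳ (g zero)))
  ∑-δ {suc n} (suc c) g =
    trans (∑-suc (λ i → ⟦ ⌊ suc c Fin.≟ i ⌋ ⟧ * g i))
      (trans (∑-cong (allFin n) (λ i → cong (λ b → ⟦ b ⟧ * g (suc i)) (⌊suc≟suc⌋ i))) (∑-δ c (g ∘ suc)))
    where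
    ⌊suc≟suc⌋ : ∀ i → ⌊ suc c Fin.≟ suc i ⌋ ≡ ⌊ c Fin.≟ i ⌋
    ⌊suc≟suc⌋ i = trans (isYes≗does (suc c Fin.≟ suc i)) (sym (isYes≗does (c Fin.≟ i)))

  ∑-term : {n : ℕ} (f : Fin n → ℕ) (i : Fin n) → f i ≤ ∑ (allFin n) f
  ∑-term {suc n} f zero    = m≤m+n (f zero) _
  ∑-term {suc n} f (suc i) =
    ≤-trans (∑-term (f ∘ suc) i) (≤-trans (m≤n+m _ (f zero)) (≤-reflexive (sym (∑-suc f))))

  -- The averaging principle. It later picks the image of the next vertex of an embedding, and a
  -- homomorphism behind a type of positive mass.
  ∑-<⇒∃ : {A : Set} (xs : List A) (f g : A → ℕ) → ∑ xs f < ∑ xs g → ∃ λ x → f x < g x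
  ∑-<⇒∃ (x ∷ xs) f g lt with f x <? g x
  ... | yes p = x , p
  ... | no ¬p = ∑-<⇒∃ xs f g (+-cancelˡ-< (f x) _ _ (<-≤-trans lt (+-monoˡ-≤ _ (≮⇒≥ ¬p))))

  countL-∑ : {A : Set} (p : A → Bool) (xs : List A) → countL p xs ≡ ∑ xs (λ x → ⟦ p x ⟧)
  countL-∑ p []       = refl
  countL-∑ p (x ∷ xs) with p x
  ... | true  = cong suc (countL-∑ p xs)
  ... | false = countL-∑ p xs

  true≢false : true ≢ false
  true≢false ()

  ⌊⌋-true : {P : Set} (d : Dec P) → ⌊ d ⌋ ≡ true → P
  ⌊⌋-true (yes p) _ = p

  true-⌊⌋ : {P : Set} (d : Dec P) → P → ⌊ d ⌋ ≡ true
  true-⌊⌋ (yes p) _ = refl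
  true-⌊⌋ (no ¬p) p = ⊥-elim (¬p p)

  ∧-true : ∀ a b → a ∧ b ≡ true → (a ≡ true) × (b ≡ true)
  ∧-true true true _ = refl , refl

  ⟦∧⟧ : ∀ a b → ⟦ a ∧ b ⟧ ≡ ⟦ a ⟧ * ⟦ b ⟧
  ⟦∧⟧ true  b = sym (+-identityʳ ⟦ b ⟧)
  ⟦∧⟧ false b = refl

  ⟦⟧≤1 : ∀ a → ⟦ a ⟧ ≤ 1
  ⟦⟧≤1 true  = ≤-refl
  ⟦⟧≤1 false = z≤n

  -- Sorting the vertices by class: inserting the delta function of `P u` makes the class a free
  -- index, and the two sums are then exchanged.
  ∑-fibre : {n r : ℕ} (P : Fin n → Fin r) (f : Fin r → Fin n → ℕ) →
            ∑ (allFin n) (λ u → f (P u) u) ≡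
            ∑ (allFin r) (λ i → ∑ (allFin n) (λ u → ⟦ ⌊ P u Fin.≟ i ⌋ ⟧ * f i u))
  ∑-fibre {n} {r} P f =
    trans (∑-cong (allFin n) (λ u → sym (∑-δ (P u) (λ i → f i u))))
          (∑-swap (allFin n) (allFin r) _)

  card : {n : ℕ} → (Fin n → Bool) → ℕ
  card {n} X = ∑ (allFin n) (λ u → ⟦ X u ⟧)

  ∑∑ : {n : ℕ} → (Fin n → Fin n → ℕ) → ℕ
  ∑∑ {n} f = ∑ (allFin n) (λ u → ∑ (allFin n) (f u))

  ∑∑-cong : {n : ℕ} {f g : Fin n → Fin n → ℕ} → (∀ u v → f u v ≡ g u v) → ∑∑ f ≡ ∑∑ g
  ∑∑-cong {n} h = ∑-cong (allFin n) (λ u → ∑-cong (allFin n) (h u))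

  ∑∑-mono : {n : ℕ} {f g : Fin n → Fin n → ℕ} → (∀ u v → f u v ≤ g u v) → ∑∑ f ≤ ∑∑ g
  ∑∑-mono {n} h = ∑-mono (allFin n) (λ u → ∑-mono (allFin n) (h u))

  ∑∑-+ : {n : ℕ} (f g : Fin n → Fin n → ℕ) → ∑∑ (λ u v → f u v + g u v) ≡ ∑∑ f + ∑∑ g
  ∑∑-+ {n} f g = trans (∑-cong (allFin n) (λ u → ∑-+ (allFin n) (f u) (g u))) (∑-+ (allFin n) _ _)

  ∑∑-*ˡ : {n : ℕ} (c : ℕ) (f : Fin n → Fin n → ℕ) → ∑∑ (λ u v → c * f u v) ≡ c * ∑∑ f
  ∑∑-*ˡ {n} c f = trans (∑-cong (allFin n) (λ u → ∑-*ˡ c (allFin n) (f u))) (∑-*ˡ c (allFin n) _)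

  card-*-card : {n : ℕ} (X Y : Fin n → Bool) → ∑∑ (λ u v → ⟦ X u ⟧ * ⟦ Y v ⟧) ≡ card X * card Y
  card-*-card {n} X Y =
    trans (∑-cong (allFin n) (λ u → ∑-*ˡ ⟦ X u ⟧ (allFin n) _)) (∑-*ʳ (card Y) (allFin n) _)

  -- With it, areas and edge counts over pairs of vertices become sums over pairs of classes, where
  -- each pair of classes contributes a rectangle.
  ∑∑-fibre : {n r : ℕ} (P : Fin n → Fin r) (f : Fin r → Fin r → Fin n → Fin n → ℕ) →
    ∑∑ (λ u v → f (P u) (P v) u v) ≡
    ∑∑ (λ i j → ∑∑ (λ u v → ⟦ ⌊ P u Fin.≟ i ⌋ ⟧ * (⟦ ⌊ P v Fin.≟ j ⌋ ⟧ * f i j u v)))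
  ∑∑-fibre {n} {r} P f =
    trans (∑-cong (allFin n) (λ u → ∑-fibre P (λ j v → f (P u) j u v)))
    (trans (∑-fibre P (λ i u → ∑ (allFin r) (λ j → ∑ (allFin n) (λ v → ⟦ ⌊ P v Fin.≟ j ⌋ ⟧ * f i j u v))))
    (∑-cong (allFin r) (λ i →
      trans (∑-cong (allFin n) (λ u →
        trans (sym (∑-*ˡ ⟦ ⌊ P u Fin.≟ i ⌋ ⟧ (allFin r) _))
              (∑-cong (allFin r) (λ j → sym (∑-*ˡ ⟦ ⌊ P u Fin.≟ i ⌋ ⟧ (allFin n) _)))))
        (∑-swap (allFin n) (allFin r) _))))

  length-allFin : ∀ n → length (allFin n) ≡ n
  length-allFin n = length-tabulate id

-- Passage between ℚ and ℕ: common denominators and cleared inequalities.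

module Rationals where

  open FiniteSums
  open import Data.Integer as ℤ using (+_; -[1+_])
  import Data.Integer.Properties as ℤ
  import Data.Nat as ℕ
  import Data.Nat.Properties as ℕ
  open import Data.Rational using (ℚ; mkℚ; 0ℚ; 1ℚ; _/_; toℚᵘ; _+_; _*_; _-_; -_; _≤_; _<_; *≤*; Positive; NonNegative)
  open import Data.Rational.Properties
  open import Data.Rational.Solver using (module +-*-Solver)
  open import Data.Rational.Unnormalised as ℚᵘ using (mkℚᵘ; *≡*)
  import Data.Rational.Unnormalised.Properties as ℚᵘ
  open +-*-Solver

  toℚᵘ-ℕ→ℚ : ∀ m → toℚᵘ (ℕ→ℚ m) ℚᵘ.≃ mkℚᵘ (+ m) 0
  toℚᵘ-ℕ→ℚ m = toℚᵘ-fromℚᵘ (mkℚᵘ (+ m) 0)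

  ℕ→ℚ-+ : ∀ m n → ℕ→ℚ (m ℕ.+ n) ≡ ℕ→ℚ m + ℕ→ℚ n
  ℕ→ℚ-+ m n = toℚᵘ-injective (ℚᵘ.≃-trans (toℚᵘ-ℕ→ℚ (m ℕ.+ n)) (ℚᵘ.≃-trans (*≡* (cong (ℤ._* + 1) integral))
    (ℚᵘ.≃-sym (ℚᵘ.≃-trans (toℚᵘ-homo-+ (ℕ→ℚ m) (ℕ→ℚ n)) (ℚᵘ.+-cong (toℚᵘ-ℕ→ℚ m) (toℚᵘ-ℕ→ℚ n))))))
    where
    integral : + (m ℕ.+ n) ≡ + m ℤ.* + 1 ℤ.+ + n ℤ.* + 1
    integral = trans (ℤ.pos-+ m n) (cong₂ ℤ._+_ (sym (ℤ.*-identityʳ (+ m))) (sym (ℤ.*-identityʳ (+ n))))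

  ℕ→ℚ-* : ∀ m n → ℕ→ℚ (m ℕ.* n) ≡ ℕ→ℚ m * ℕ→ℚ n
  ℕ→ℚ-* m n = toℚᵘ-injective (ℚᵘ.≃-trans (toℚᵘ-ℕ→ℚ (m ℕ.* n)) (ℚᵘ.≃-trans (*≡* (cong (ℤ._* + 1) (ℤ.pos-* m n)))
    (ℚᵘ.≃-sym (ℚᵘ.≃-trans (toℚᵘ-homo-* (ℕ→ℚ m) (ℕ→ℚ n)) (ℚᵘ.*-cong (toℚᵘ-ℕ→ℚ m) (toℚᵘ-ℕ→ℚ n))))))

  ℕ→ℚ-mono : ∀ {m n} → m ℕ.≤ n → ℕ→ℚ m ≤ ℕ→ℚ n
  ℕ→ℚ-mono {m} {n} m≤n = toℚᵘ-cancel-≤ (ℚᵘ.≤-respˡ-≃ (ℚᵘ.≃-sym (toℚᵘ-ℕ→ℚ m)) (ℚᵘ.≤-respʳ-≃ (ℚᵘ.≃-sym (toℚᵘ-ℕ→ℚ n))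
    (ℚᵘ.*≤* (ℤ.*-monoʳ-≤-nonNeg (+ 1) (ℤ.+≤+ m≤n)))))

  ℕ→ℚ-cancel : ∀ {m n} → ℕ→ℚ m ≤ ℕ→ℚ n → m ℕ.≤ n
  ℕ→ℚ-cancel {m} {n} le with ℚᵘ.≤-respˡ-≃ (toℚᵘ-ℕ→ℚ m) (ℚᵘ.≤-respʳ-≃ (toℚᵘ-ℕ→ℚ n) (toℚᵘ-mono-≤ le))
  ... | ℚᵘ.*≤* le′ = ℤ.drop‿+≤+ (subst₂ ℤ._≤_ (ℤ.*-identityʳ (+ m)) (ℤ.*-identityʳ (+ n)) le′)

  ℕ→ℚ-nonNeg : ∀ m → NonNegative (ℕ→ℚ m)
  ℕ→ℚ-nonNeg m = normalize-nonNeg m 1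

  ℕ→ℚ-pos : ∀ m → 1 ℕ.≤ m → Positive (ℕ→ℚ m)
  ℕ→ℚ-pos m@(suc _) _ = normalize-pos m 1

  clear-denominator : ∀ p → 0ℚ ≤ p → ∃₂ λ Z N → (1 ℕ.≤ Z) × (p * ℕ→ℚ Z ≡ ℕ→ℚ N)
  clear-denominator p@(mkℚ (+ N) d _) _ = suc d , N , ℕ.s≤s ℕ.z≤n ,
    toℚᵘ-injective (ℚᵘ.≃-trans (toℚᵘ-homo-* p (ℕ→ℚ (suc d))) (ℚᵘ.≃-trans (ℚᵘ.*-congˡ {toℚᵘ p} (toℚᵘ-ℕ→ℚ (suc d)))
      (ℚᵘ.≃-trans (*≡* (trans (ℤ.*-identityʳ _) (cong (λ e → + N ℤ.* + e) (sym (ℕ.*-identityʳ (suc d)))))) (ℚᵘ.≃-sym (toℚᵘ-ℕ→ℚ N)))))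
  clear-denominator (mkℚ -[1+ _ ] _ _) (*≤* ())

  -- The denominator of p already works: multiplied by it, p becomes its numerator, which is at
  -- least 1.
  archimedean : ∀ p → 0ℚ < p → ∃ λ Q → (1 ℕ.≤ Q) × (1ℚ ≤ p * ℕ→ℚ Q)
  archimedean p 0<p with clear-denominator p (<⇒≤ 0<p)
  ... | Z , suc N , 1≤Z , pZ≡N = Z , 1≤Z , ≤-trans (ℕ→ℚ-mono {1} {suc N} (ℕ.s≤s ℕ.z≤n)) (≤-reflexive (sym pZ≡N))
  ... | Z , zero  , 1≤Z , pZ≡0 = ⊥-elim (<-irrefl (sym pZ≡0)
      (≤-<-trans (≤-reflexive (sym (*-zeroˡ (ℕ→ℚ Z)))) (*-monoˡ-<-pos (ℕ→ℚ Z) 0<p)))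
    where
    instance _ = ℕ→ℚ-pos Z 1≤Z

  ∑-map : {A B : Set} (f : A → B) (xs : List A) (g : B → ℕ) → ∑ (map f xs) g ≡ ∑ xs (g ∘ f)
  ∑-map f []       g = refl
  ∑-map f (x ∷ xs) g = cong (g (f x) ℕ.+_) (∑-map f xs g)

  ℕ→ℚ-*-*-+ : ∀ N q γ Z T → ℕ→ℚ (N ℕ.* q ℕ.* γ ℕ.+ Z ℕ.* T) ≡ ℕ→ℚ N * ℕ→ℚ q * ℕ→ℚ γ + ℕ→ℚ Z * ℕ→ℚ T
  ℕ→ℚ-*-*-+ N q γ Z T = trans (ℕ→ℚ-+ (N ℕ.* q ℕ.* γ) (Z ℕ.* T))
    (cong₂ _+_ (trans (ℕ→ℚ-* (N ℕ.* q) γ) (cong (_* ℕ→ℚ γ) (ℕ→ℚ-* N q))) (ℕ→ℚ-* Z T))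

  clear-step : ∀ ω γ S Z q {N T} → ω * Z ≡ N → S * q ≡ T → (ω * γ + S) * (Z * q) ≡ N * q * γ + Z * T
  clear-step ω γ S Z q refl refl = distribute ω γ S Z q
    where
    distribute : ∀ ω γ S Z q → (ω * γ + S) * (Z * q) ≡ (ω * Z) * q * γ + Z * (S * q)
    distribute = solve 5 (λ ω γ S Z q → (ω :* γ :+ S) :* (Z :* q) := (ω :* Z) :* q :* γ :+ Z :* (S :* q)) refl

  module _ {A : Set} where

    weighted : List (A × ℚ) → (A → ℕ) → ℚ
    weighted L g = sumℚ (map (λ p → proj₂ p * ℕ→ℚ (g (proj₁ p))) L)

    weightedℕ : List (A × ℕ) → (A → ℕ) → ℕ
    weightedℕ w g = ∑ w (λ p → proj₂ p ℕ.* g (proj₁ p))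

    -- `equal` is quantified over g so that a single clearing serves all constraints at once: g = 1
    -- gives the total weight, and g = `preimage` at v gives the capacity of the vertex v.
    record Cleared (L : List (A × ℚ)) : Set where
      field
        denominator          : ℕ
        numerators           : List (A × ℕ)
        denominator-positive : 1 ℕ.≤ denominator
        equal                : ∀ g → weighted L g * ℕ→ℚ denominator ≡ ℕ→ℚ (weightedℕ numerators g)

    cleared-[] : Cleared []
    cleared-[] = record { denominator = 1 ; numerators = [] ; denominator-positive = ℕ.≤-refl ; equal = λ _ → refl }

    cleared-∷ : ∀ x ω {L} Z N → 1 ℕ.≤ Z → ω * ℕ→ℚ Z ≡ ℕ→ℚ N → Cleared L → Cleared ((x , ω) ∷ L)
    cleared-∷ x ω {L} Z N 1≤Z ωZ≡N C = record
      { denominator          = Z ℕ.* q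
      ; numerators           = (x , N ℕ.* q) ∷ map scale w
      ; denominator-positive = ℕ.*-mono-≤ 1≤Z denominator-positive
      ; equal                = λ g → trans (cong ((ω * ℕ→ℚ (g x) + weighted L g) *_) (ℕ→ℚ-* Z q))
          (trans (clear-step ω (ℕ→ℚ (g x)) (weighted L g) (ℕ→ℚ Z) (ℕ→ℚ q) ωZ≡N (equal g))
            (trans (sym (ℕ→ℚ-*-*-+ N q (g x) Z (weightedℕ w g)))
              (cong ℕ→ℚ (cong (λ t → N ℕ.* q ℕ.* g x ℕ.+ t) (scaled g)))))
      }
      where
      open Cleared C renaming (denominator to q; numerators to w)
      scale : A × ℕ → A × ℕ
      scale (y , p) = y , Z ℕ.* p
      scaled : ∀ g → Z ℕ.* weightedℕ w g ≡ weightedℕ (map scale w) g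
      scaled g = trans (sym (∑-*ˡ Z w _))
        (trans (∑-cong w (λ p → sym (ℕ.*-assoc Z (proj₂ p) (g (proj₁ p))))) (sym (∑-map scale w _)))

    common-denominator : (L : List (A × ℚ)) → All (λ p → 0ℚ ≤ proj₂ p) L → Cleared L
    common-denominator []            []          = cleared-[]
    common-denominator ((x , ω) ∷ L) (0≤ω ∷ 0≤L) =
      let Z , N , 1≤Z , ωZ≡N = clear-denominator ω 0≤ω
      in  cleared-∷ x ω Z N 1≤Z ωZ≡N (common-denominator L 0≤L)

  1/ℚ : ℕ → ℚ
  1/ℚ z = + 1 / suc z

  1/ℚ-pos : ∀ z → 0ℚ < 1/ℚ z
  1/ℚ-pos z = positive⁻¹ (1/ℚ z) {{normalize-pos 1 (suc z)}}

  1/ℚ-* : ∀ z → 1/ℚ z * ℕ→ℚ (suc z) ≡ 1ℚ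
  1/ℚ-* z = toℚᵘ-injective (ℚᵘ.≃-trans (toℚᵘ-homo-* (1/ℚ z) (ℕ→ℚ (suc z)))
    (ℚᵘ.≃-trans (ℚᵘ.*-cong (toℚᵘ-fromℚᵘ (mkℚᵘ (+ 1) z)) (toℚᵘ-ℕ→ℚ (suc z)))
      (*≡* (trans (ℤ.*-identityʳ _) (trans (ℤ.*-identityˡ (+ suc z)) (sym (trans (ℤ.*-identityˡ _) (cong +_ (ℕ.*-identityʳ (suc z))))))))))

  ≤1/ℚ⇒*≤1 : ∀ ρ z → ρ ≤ 1/ℚ z → ρ * ℕ→ℚ (suc z) ≤ 1ℚ
  ≤1/ℚ⇒*≤1 ρ z ρ≤ = ≤-trans (*-monoʳ-≤-nonNeg (ℕ→ℚ (suc z)) {{ℕ→ℚ-nonNeg (suc z)}} {ρ} {1/ℚ z} ρ≤)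
                            (≤-reflexive (1/ℚ-* z))

  p-q≤r : ∀ p q r → p ≤ q + r → p - q ≤ r
  p-q≤r p q r p≤q+r = ≤-trans (+-monoˡ-≤ (- q) p≤q+r) (≤-reflexive
    (trans (cong (_- q) (+-comm q r)) (trans (+-assoc r q (- q)) (trans (cong (λ t → r + t) (+-inverseʳ q)) (+-identityʳ r)))))

  -- Since p is at least 1/Z, an error of n/Z is at most p n. The degree, size and covering
  -- estimates proved in ℕ return to ℚ through this.
  ≤-from-multiple : ∀ p Z x y n → 1 ℕ.≤ Z → 1ℚ ≤ p * ℕ→ℚ Z → Z ℕ.* x ℕ.≤ Z ℕ.* y ℕ.+ n →
                    ℕ→ℚ x - p * ℕ→ℚ n ≤ ℕ→ℚ y
  ≤-from-multiple p Z x y n 1≤Z 1≤pZ Zx≤ = p-q≤r (ℕ→ℚ x) (p * ℕ→ℚ n) (ℕ→ℚ y) (*-cancelˡ-≤-pos (ℕ→ℚ Z) (begin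
    ℕ→ℚ Z * ℕ→ℚ x                          ≡⟨ sym (ℕ→ℚ-* Z x) ⟩
    ℕ→ℚ (Z ℕ.* x)                          ≤⟨ ℕ→ℚ-mono Zx≤ ⟩
    ℕ→ℚ (Z ℕ.* y ℕ.+ n)                    ≡⟨ trans (ℕ→ℚ-+ (Z ℕ.* y) n) (cong₂ _+_ (ℕ→ℚ-* Z y) (sym (*-identityˡ (ℕ→ℚ n)))) ⟩
    ℕ→ℚ Z * ℕ→ℚ y + 1ℚ * ℕ→ℚ n             ≤⟨ +-monoʳ-≤ (ℕ→ℚ Z * ℕ→ℚ y) (*-monoʳ-≤-nonNeg (ℕ→ℚ n) {{ℕ→ℚ-nonNeg n}} 1≤pZ) ⟩
    ℕ→ℚ Z * ℕ→ℚ y + p * ℕ→ℚ Z * ℕ→ℚ n      ≡⟨ factor (ℕ→ℚ Z) (ℕ→ℚ y) p (ℕ→ℚ n) ⟩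
    ℕ→ℚ Z * (p * ℕ→ℚ n + ℕ→ℚ y)            ∎))
    where
    open ≤-Reasoning
    instance _ = ℕ→ℚ-pos Z 1≤Z
    factor : ∀ Z y p n → Z * y + p * Z * n ≡ Z * (p * n + y)
    factor = solve 4 (λ Z y p n → Z :* y :+ p :* Z :* n := Z :* (p :* n :+ y)) refl

  [1-p]n≡n-pn : ∀ p x → (1ℚ - p) * x ≡ x - p * x
  [1-p]n≡n-pn p x = trans (*-distribʳ-+ x 1ℚ (- p)) (cong₂ _+_ (*-identityˡ x) (sym (neg-distribˡ-* p x)))

  -- The opposite direction: the weight hypothesis is multiplied by Z q, and ρ Z ≤ 1 replaces the
  -- defect ρ n by n/Z. Here h is the order of B, S the total of the rational weights and P the
  -- total of their numerators over the common denominator q.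
  weight-in-ℕ : ∀ ρ z n h P q S → 1 ℕ.≤ q → ρ * ℕ→ℚ (suc z) ≤ 1ℚ → S * ℕ→ℚ q ≡ ℕ→ℚ P →
                (1ℚ - ρ) * ℕ→ℚ n ≤ ℕ→ℚ h * S →
                suc z ℕ.* (n ℕ.* q) ℕ.≤ suc z ℕ.* (h ℕ.* P) ℕ.+ n ℕ.* q
  weight-in-ℕ ρ z n h P q S 1≤q ρZ≤1 Sq≡P weight = ℕ→ℚ-cancel (begin
    ℕ→ℚ (Z ℕ.* (n ℕ.* q))                          ≡⟨ trans (ℕ→ℚ-* Z (n ℕ.* q)) (cong (ℕ→ℚ Z *_) (ℕ→ℚ-* n q)) ⟩
    ℕ→ℚ Z * (ℕ→ℚ n * ℕ→ℚ q)                        ≡⟨ split (ℕ→ℚ Z) (ℕ→ℚ n) (ℕ→ℚ q) ρ ⟩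
    ℕ→ℚ Z * ℕ→ℚ q * (ℕ→ℚ n - ρ * ℕ→ℚ n) + ρ * ℕ→ℚ Z * (ℕ→ℚ n * ℕ→ℚ q)
      ≤⟨ +-mono-≤ (*-monoˡ-≤-nonNeg (ℕ→ℚ Z * ℕ→ℚ q) {{subst NonNegative (ℕ→ℚ-* Z q) (ℕ→ℚ-nonNeg (Z ℕ.* q))}}
                     (≤-trans (≤-reflexive (sym ([1-p]n≡n-pn ρ (ℕ→ℚ n)))) weight))
                  (*-monoʳ-≤-nonNeg (ℕ→ℚ n * ℕ→ℚ q) {{subst NonNegative (ℕ→ℚ-* n q) (ℕ→ℚ-nonNeg (n ℕ.* q))}} ρZ≤1) ⟩
    ℕ→ℚ Z * ℕ→ℚ q * (ℕ→ℚ h * S) + 1ℚ * (ℕ→ℚ n * ℕ→ℚ q)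
      ≡⟨ cong₂ _+_ (regroup (ℕ→ℚ Z) (ℕ→ℚ q) (ℕ→ℚ h) S) (*-identityˡ (ℕ→ℚ n * ℕ→ℚ q)) ⟩
    ℕ→ℚ Z * (ℕ→ℚ h * (S * ℕ→ℚ q)) + ℕ→ℚ n * ℕ→ℚ q
      ≡⟨ cong₂ _+_ (trans (cong (λ t → ℕ→ℚ Z * (ℕ→ℚ h * t)) Sq≡P) (trans (cong (ℕ→ℚ Z *_) (sym (ℕ→ℚ-* h P))) (sym (ℕ→ℚ-* Z (h ℕ.* P)))))
                   (sym (ℕ→ℚ-* n q)) ⟩
    ℕ→ℚ (Z ℕ.* (h ℕ.* P)) + ℕ→ℚ (n ℕ.* q)           ≡⟨ sym (ℕ→ℚ-+ (Z ℕ.* (h ℕ.* P)) (n ℕ.* q)) ⟩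
    ℕ→ℚ (Z ℕ.* (h ℕ.* P) ℕ.+ n ℕ.* q)               ∎)
    where
    open ≤-Reasoning
    Z = suc z
    split : ∀ Z n q ρ → Z * (n * q) ≡ Z * q * (n - ρ * n) + ρ * Z * (n * q)
    split = solve 4 (λ Z n q ρ → Z :* (n :* q) := Z :* q :* (n :- ρ :* n) :+ ρ :* Z :* (n :* q)) refl
    regroup : ∀ Z q h S → Z * q * (h * S) ≡ Z * (h * (S * q))
    regroup = solve 4 (λ Z q h S → Z :* q :* (h :* S) := Z :* (h :* (S :* q))) refl

-- Edge counts, vertex classes and the encoding of a refined partition.

module Tilings where

  open FiniteSums
  open Rationals
  open import Data.Nat using (_+_; _*_; _∸_; _^_; _/_; _≤_; _<_; _≥_; _≤?_; _<?_)
  open import Data.Nat.DivMod using (m≡m%n+[m/n]*n; m%n<n; m/n*n≤m; 0/n≡0)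
  open import Data.Nat.Properties
  open import Data.Rational as ℚ using (ℚ; 0ℚ; 1ℚ)
  import Data.Rational.Properties as ℚ

  edges : {n : ℕ} (A : Fin n → Fin n → Bool) (X Y : Fin n → Bool) → ℕ
  edges A X Y = ∑∑ (λ u v → ⟦ X u ⟧ * (⟦ Y v ⟧ * ⟦ A u v ⟧))

  class : {n r : ℕ} → (Fin n → Fin r) → Fin r → Fin n → Bool
  class P i u = ⌊ P u Fin.≟ i ⌋

  _∩ᵇ_ : {n : ℕ} → (Fin n → Bool) → (Fin n → Bool) → Fin n → Bool
  (X ∩ᵇ Y) u = X u ∧ Y u

  card-cong : {n : ℕ} {X Y : Fin n → Bool} → (∀ u → X u ≡ Y u) → card X ≡ card Y
  card-cong {n} h = ∑-cong (allFin n) (λ u → cong ⟦_⟧ (h u))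

  edges-cong : {n : ℕ} (A : Fin n → Fin n → Bool) {X X′ Y Y′ : Fin n → Bool} →
               (∀ u → X u ≡ X′ u) → (∀ u → Y u ≡ Y′ u) → edges A X Y ≡ edges A X′ Y′
  edges-cong A X≡ Y≡ =
    ∑∑-cong (λ u v → cong₂ _*_ (cong ⟦_⟧ (X≡ u)) (cong (λ b → ⟦ b ⟧ * ⟦ A u v ⟧) (Y≡ v)))

  ⟦∨⟧-disjoint : ∀ a b → (a ≡ true → b ≡ false) → ⟦ a ∨ b ⟧ ≡ ⟦ a ⟧ + ⟦ b ⟧
  ⟦∨⟧-disjoint true  b a⇒¬b rewrite a⇒¬b refl = refl
  ⟦∨⟧-disjoint false b a⇒¬b = refl

  -- A vertex of the refinement remembers its old class and, for each of the r classes, one bit for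
  -- the row side and one bit for the column side of the rectangle chosen with that class.
  refinedSize : ℕ → ℕ
  refinedSize r = r * (2 ^ r * 2 ^ r)

  -- The sizes of all rounds are added up, so the bound holds no matter at which round the
  -- refinement stops.
  partsBound : ℕ → ℕ → ℕ
  partsBound zero    r = r
  partsBound (suc s) r = r + partsBound s (refinedSize r)

  toBit : Bool → Fin 2
  toBit true  = suc zero
  toBit false = zero

  fromBit : Fin 2 → Bool
  fromBit zero    = false
  fromBit (suc _) = true

  fromBit∘toBit : ∀ b → fromBit (toBit b) ≡ b
  fromBit∘toBit true  = refl
  fromBit∘toBit false = refl

  module Encoding (r : ℕ) where

    encode : Fin r → (Fin r → Bool) → (Fin r → Bool) → Fin (refinedSize r)
    encode i x y = combine i (combine (funToFin (toBit ∘ x)) (funToFin (toBit ∘ y)))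

    oldClass : Fin (refinedSize r) → Fin r
    oldClass = proj₁ ∘ remQuot {r} (2 ^ r * 2 ^ r)

    bits : Fin (refinedSize r) → Fin (2 ^ r) × Fin (2 ^ r)
    bits = remQuot {2 ^ r} (2 ^ r) ∘ proj₂ ∘ remQuot {r} (2 ^ r * 2 ^ r)

    rowBit columnBit : Fin (refinedSize r) → Fin r → Bool
    rowBit    c j = fromBit (finToFun (proj₁ (bits c)) j)
    columnBit c j = fromBit (finToFun (proj₂ (bits c)) j)

    oldClass-encode : ∀ i x y → oldClass (encode i x y) ≡ i
    oldClass-encode i x y = cong proj₁ (remQuot-combine i _)

    bits-encode : ∀ i x y → bits (encode i x y) ≡ (funToFin (toBit ∘ x) , funToFin (toBit ∘ y))
    bits-encode i x y = trans (cong (remQuot {2 ^ r} (2 ^ r) ∘ proj₂) (remQuot-combine i _))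
                              (remQuot-combine (funToFin (toBit ∘ x)) (funToFin (toBit ∘ y)))

    rowBit-encode : ∀ i x y j → rowBit (encode i x y) j ≡ x j
    rowBit-encode i x y j = trans (cong (λ b → fromBit (finToFun (proj₁ b) j)) (bits-encode i x y))
      (trans (cong fromBit (finToFun-funToFin (toBit ∘ x) j)) (fromBit∘toBit (x j)))

    columnBit-encode : ∀ i x y j → columnBit (encode i x y) j ≡ y j
    columnBit-encode i x y j = trans (cong (λ b → fromBit (finToFun (proj₂ b) j)) (bits-encode i x y))
      (trans (cong fromBit (finToFun-funToFin (toBit ∘ y) j)) (fromBit∘toBit (y j)))

  -- Lower-regular partitions by removal of sparse rectangles.

  module Regularity {n : ℕ} (A : Fin n → Fin n → Bool) (D E : ℕ) where

    -- After division by E this reads D e(X,Y) + |Pᵢ||Pⱼ|/E < |X||Y|. The one inequality makes the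
    -- rectangle sparse (drop the second summand) and large (drop the first), and its negation is
    -- lower regularity with an additive error of |Pᵢ||Pⱼ|/E.
    Irregular : {r : ℕ} (P : Fin n → Fin r) (i j : Fin r) (X Y : Fin n → Bool) → Set
    Irregular P i j X Y =
      E * (D * edges A (class P i ∩ᵇ X) (class P j ∩ᵇ Y)) + card (class P i) * card (class P j) <
      E * (card (class P i ∩ᵇ X) * card (class P j ∩ᵇ Y))

    irregular? : {r : ℕ} (P : Fin n → Fin r) (i j : Fin r) →
      Dec (∃ λ (X : Subset n) → ∃ λ (Y : Subset n) → Irregular P i j (Vec.lookup X) (Vec.lookup Y))
    irregular? P i j = anySubset? (λ X → anySubset? (λ Y → _ <? _))

    irregularᵇ : {r : ℕ} (P : Fin n → Fin r) (i j : Fin r) → Bool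
    irregularᵇ P i j = ⌊ irregular? P i j ⌋

    -- The search runs over the finite type `Subset n`; tabulation carries arbitrary Boolean
    -- functions there, and intersecting with the classes changes nothing because X and Y already
    -- lie in them.
    regular⇒≤ : {r : ℕ} (P : Fin n → Fin r) (i j : Fin r) → irregularᵇ P i j ≡ false →
      (X Y : Fin n → Bool) → (∀ u → X u ≡ true → P u ≡ i) → (∀ u → Y u ≡ true → P u ≡ j) →
      E * (card X * card Y) ≤ E * (D * edges A X Y) + card (class P i) * card (class P j)
    regular⇒≤ P i j reg X Y X⊆ Y⊆ with irregular? P i j
    regular⇒≤ P i j () X Y X⊆ Y⊆ | yes _
    ... | no ¬irr = ≮⇒≥ λ lt → ¬irr (Vec.tabulate X , Vec.tabulate Y , subst id (bound X Y X⊆ Y⊆) lt)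
      where
      same : ∀ (i : Fin _) (X : Fin n → Bool) → (∀ u → X u ≡ true → P u ≡ i) →
             ∀ u → X u ≡ (class P i ∩ᵇ Vec.lookup (Vec.tabulate X)) u
      same i X X⊆ u rewrite lookup∘tabulate X u with X u in eq
      ... | true  rewrite true-⌊⌋ (P u Fin.≟ i) (X⊆ u eq) = refl
      ... | false with ⌊ P u Fin.≟ i ⌋
      ... | true  = refl
      ... | false = refl
      bound : ∀ (X Y : Fin n → Bool) X⊆ Y⊆ →
        (E * (D * edges A X Y) + card (class P i) * card (class P j) < E * (card X * card Y)) ≡
        Irregular P i j (Vec.lookup (Vec.tabulate X)) (Vec.lookup (Vec.tabulate Y))
      bound X Y X⊆ Y⊆ = cong₂ (λ e c → E * (D * e) + card (class P i) * card (class P j) < E * c)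
        (edges-cong A (same i X X⊆) (same j Y Y⊆))
        (cong₂ _*_ (card-cong (same i X X⊆)) (card-cong (same j Y Y⊆)))

    -- `R` marks the removed pairs of classes and is a relation on ordered pairs, not assumed
    -- symmetric. `sparse` is the invariant: the removed area has edge density at most 1/D.
    record State (r : ℕ) : Set where
      field
        P      : Fin n → Fin r
        R      : Fin r → Fin r → Bool
        sparse : D * ∑∑ (λ u v → ⟦ R (P u) (P v) ⟧ * ⟦ A u v ⟧) ≤ ∑∑ (λ u v → ⟦ R (P u) (P v) ⟧)

      area : ℕ
      area = ∑∑ (λ u v → ⟦ R (P u) (P v) ⟧)

      fresh : Fin r → Fin r → Bool
      fresh i j = not (R i j) ∧ irregularᵇ P i j

      freshArea : ℕ
      freshArea = ∑∑ (λ u v → ⟦ fresh (P u) (P v) ⟧)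

    open State

    -- Every pair of classes receives a rectangle, the empty one when the pair is not fresh, so that
    -- all pairs are refined uniformly. `disjoint` keeps new area apart from area removed earlier,
    -- which makes areas and edge counts add up exactly.
    record Rectangle {r : ℕ} (S : State r) (i j : Fin r) : Set where
      field
        X Y      : Fin n → Bool
        disjoint : R S i j ≡ true → ∀ u → X u ≡ false
        light    : D * edges A (class (P S) i ∩ᵇ X) (class (P S) j ∩ᵇ Y) ≤
                   card (class (P S) i ∩ᵇ X) * card (class (P S) j ∩ᵇ Y)
        large    : ⟦ fresh S i j ⟧ * (card (class (P S) i) * card (class (P S) j)) ≤
                   E * (card (class (P S) i ∩ᵇ X) * card (class (P S) j ∩ᵇ Y))

    open Rectangle

    edges-empty : (X Y : Fin n → Bool) → (∀ u → X u ≡ false) → edges A X Y ≡ 0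
    edges-empty X Y empty = trans
      (∑∑-cong (λ u v → cong (λ b → ⟦ b ⟧ * (⟦ Y v ⟧ * ⟦ A u v ⟧)) (empty u)))
      (trans (∑-cong (allFin n) (λ _ → ∑-zero (allFin n))) (∑-zero (allFin n)))

    emptyRectangle : {r : ℕ} (S : State r) (i j : Fin r) → fresh S i j ≡ false → Rectangle S i j
    emptyRectangle S i j notFresh = record
      { X = const false ; Y = const false
      ; disjoint = λ _ _ → refl
      ; light = ≤-trans (≤-reflexive (trans (cong (D *_) (edges-empty _ (class (P S) j ∩ᵇ const false) empty)) (*-zeroʳ D))) z≤n
      ; large = ≤-trans (≤-reflexive (cong (λ b → ⟦ b ⟧ * (card (class (P S) i) * card (class (P S) j))) notFresh)) z≤n
      }
      where
      empty : ∀ u → (class (P S) i ∩ᵇ const false) u ≡ false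
      empty u with class (P S) i u
      ... | true  = refl
      ... | false = refl

    rectangle : {r : ℕ} (S : State r) (i j : Fin r) → Rectangle S i j
    rectangle S i j with R S i j in eqR | irregular? (P S) i j in eqI
    ... | true | _ = emptyRectangle S i j (cong (λ b → not b ∧ irregularᵇ (P S) i j) eqR)
    ... | false | no _ = emptyRectangle S i j (cong₂ (λ b d → not b ∧ ⌊ d ⌋) eqR eqI)
    ... | false | yes (X , Y , irr) = record
      { X = Vec.lookup X ; Y = Vec.lookup Y
      ; disjoint = λ R-true → ⊥-elim (true≢false (trans (sym R-true) eqR))
      ; light = light′
      ; large = ≤-trans (*-monoˡ-≤ _ (⟦⟧≤1 (fresh S i j)))
                  (≤-trans (≤-reflexive (+-identityʳ _)) (≤-trans (m≤n+m _ _) (<⇒≤ irr)))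
      }
      where
      light′ = <⇒≤ (*-cancelˡ-< E _ _ (≤-<-trans (m≤m+n _ _) irr))

    module Step {r : ℕ} (S : State r) (W : ∀ i j → Rectangle S i j) where

      open Encoding r

      P′ : Fin n → Fin (refinedSize r)
      P′ u = encode (P S u) (λ j → X (W (P S u) j) u) (λ i → Y (W i (P S u)) u)

      -- Each of c and d stores whether it lies in its side of the rectangle of their old classes,
      -- so the two bits decide membership in it. The removed set is again a union of products of
      -- classes.
      R′ : Fin (refinedSize r) → Fin (refinedSize r) → Bool
      R′ c d = R S (oldClass c) (oldClass d) ∨ (rowBit c (oldClass d) ∧ columnBit d (oldClass c))

      added : Fin r → Fin r → Fin n → Fin n → ℕ
      added i j u v = ⟦ X (W i j) u ⟧ * ⟦ Y (W i j) v ⟧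

      R′-P′ : ∀ u v → R′ (P′ u) (P′ v) ≡
        R S (P S u) (P S v) ∨ (X (W (P S u) (P S v)) u ∧ Y (W (P S u) (P S v)) v)
      R′-P′ u v = cong₂ _∨_
        (cong₂ (R S) (oldClass-encode (P S u) _ _) (oldClass-encode (P S v) _ _))
        (cong₂ _∧_
          (trans (rowBit-encode (P S u) _ _ (oldClass (P′ v)))
                 (cong (λ j → X (W (P S u) j) u) (oldClass-encode (P S v) _ _)))
          (trans (columnBit-encode (P S v) _ _ (oldClass (P′ u)))
                 (cong (λ i → Y (W i (P S v)) v) (oldClass-encode (P S u) _ _))))

      ⟦R′⟧ : ∀ u v → ⟦ R′ (P′ u) (P′ v) ⟧ ≡ ⟦ R S (P S u) (P S v) ⟧ + added (P S u) (P S v) u v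
      ⟦R′⟧ u v = trans (cong ⟦_⟧ (R′-P′ u v))
        (trans (⟦∨⟧-disjoint _ _ (λ R-true → cong (_∧ Y (W (P S u) (P S v)) v) (disjoint (W (P S u) (P S v)) R-true u)))
               (cong (⟦ R S (P S u) (P S v) ⟧ +_) (⟦∧⟧ (X (W (P S u) (P S v)) u) (Y (W (P S u) (P S v)) v))))

      cardsOf edgesOf : Fin r → Fin r → ℕ
      cardsOf i j = card (class (P S) i ∩ᵇ X (W i j)) * card (class (P S) j ∩ᵇ Y (W i j))
      edgesOf i j = edges A (class (P S) i ∩ᵇ X (W i j)) (class (P S) j ∩ᵇ Y (W i j))

      addedArea : ∑∑ (λ u v → added (P S u) (P S v) u v) ≡ ∑∑ cardsOf
      addedArea = trans (∑∑-fibre (P S) added) (∑∑-cong λ i j → trans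
        (∑∑-cong λ u v → trans (regroup ⟦ class (P S) i u ⟧ ⟦ class (P S) j v ⟧ ⟦ X (W i j) u ⟧ ⟦ Y (W i j) v ⟧)
          (sym (cong₂ _*_ (⟦∧⟧ (class (P S) i u) (X (W i j) u)) (⟦∧⟧ (class (P S) j v) (Y (W i j) v)))))
        (card-*-card {n} _ _))
        where
        regroup : ∀ a b c d → a * (b * (c * d)) ≡ (a * c) * (b * d)
        regroup = solve-∀

      addedEdges : ∑∑ (λ u v → added (P S u) (P S v) u v * ⟦ A u v ⟧) ≡ ∑∑ edgesOf
      addedEdges = trans (∑∑-fibre (P S) (λ i j u v → added i j u v * ⟦ A u v ⟧)) (∑∑-cong λ i j →
        ∑∑-cong λ u v → trans (regroup ⟦ class (P S) i u ⟧ ⟦ class (P S) j v ⟧ ⟦ X (W i j) u ⟧ ⟦ Y (W i j) v ⟧ ⟦ A u v ⟧)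
          (sym (cong₂ _*_ (⟦∧⟧ (class (P S) i u) (X (W i j) u))
                          (cong (_* ⟦ A u v ⟧) (⟦∧⟧ (class (P S) j v) (Y (W i j) v))))))
        where
        regroup : ∀ a b c d e → a * (b * (c * d * e)) ≡ (a * c) * ((b * d) * e)
        regroup = solve-∀

      area′ : ∑∑ (λ u v → ⟦ R′ (P′ u) (P′ v) ⟧) ≡ area S + ∑∑ cardsOf
      area′ = trans (∑∑-cong ⟦R′⟧) (trans (∑∑-+ {n} _ _) (cong (area S +_) addedArea))

      sparse′ : D * ∑∑ (λ u v → ⟦ R′ (P′ u) (P′ v) ⟧ * ⟦ A u v ⟧) ≤ ∑∑ (λ u v → ⟦ R′ (P′ u) (P′ v) ⟧)
      sparse′ = begin
        D * ∑∑ (λ u v → ⟦ R′ (P′ u) (P′ v) ⟧ * ⟦ A u v ⟧)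
          ≡⟨ cong (D *_) (trans (∑∑-cong (λ u v → trans (cong (_* ⟦ A u v ⟧) (⟦R′⟧ u v)) (*-distribʳ-+ ⟦ A u v ⟧ ⟦ R S (P S u) (P S v) ⟧ _)))
               (trans (∑∑-+ {n} _ _) (cong (oldEdges +_) addedEdges))) ⟩
        D * (oldEdges + ∑∑ edgesOf)
          ≡⟨ *-distribˡ-+ D oldEdges _ ⟩
        D * oldEdges + D * ∑∑ edgesOf
          ≡⟨ cong (D * oldEdges +_) (sym (∑∑-*ˡ D edgesOf)) ⟩
        D * oldEdges + ∑∑ (λ i j → D * edgesOf i j)
          ≤⟨ +-mono-≤ (sparse S) (∑∑-mono (λ i j → light (W i j))) ⟩
        area S + ∑∑ cardsOf
          ≡⟨ sym area′ ⟩
        ∑∑ (λ u v → ⟦ R′ (P′ u) (P′ v) ⟧) ∎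
        where
        open ≤-Reasoning
        oldEdges = ∑∑ (λ u v → ⟦ R S (P S u) (P S v) ⟧ * ⟦ A u v ⟧)

      next : State (refinedSize r)
      next = record { P = P′ ; R = R′ ; sparse = sparse′ }

      freshArea≡ : freshArea S ≡ ∑∑ (λ i j → ⟦ fresh S i j ⟧ * (card (class (P S) i) * card (class (P S) j)))
      freshArea≡ = trans (∑∑-fibre (P S) (λ i j _ _ → ⟦ fresh S i j ⟧)) (∑∑-cong λ i j → trans
        (∑∑-cong λ u v → regroup ⟦ class (P S) i u ⟧ ⟦ class (P S) j v ⟧ ⟦ fresh S i j ⟧)
        (trans (∑∑-*ˡ {n} ⟦ fresh S i j ⟧ _) (cong (⟦ fresh S i j ⟧ *_) (card-*-card {n} (class (P S) i) (class (P S) j)))))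
        where
        regroup : ∀ a b c → a * (b * c) ≡ c * (a * b)
        regroup = solve-∀

      -- By `large`, each fresh pair yields a rectangle of at least a 1/E share of its area. The
      -- extra 1 is the strictness of the hypothesis; it keeps the starting budget of `iterate`
      -- strict even for n = 0.
      grows : n * n < E * freshArea S → E * E * area S + (n * n + 1) ≤ E * E * area next
      grows lt = begin
        E * E * area S + (n * n + 1)        ≡⟨ cong (E * E * area S +_) (+-comm _ 1) ⟩
        E * E * area S + suc (n * n)        ≤⟨ +-monoʳ-≤ (E * E * area S) lt ⟩
        E * E * area S + E * freshArea S    ≤⟨ +-monoʳ-≤ (E * E * area S) (*-monoʳ-≤ E (≤-trans (≤-reflexive freshArea≡)
                                                 (≤-trans (∑∑-mono (λ i j → large (W i j))) (≤-reflexive (∑∑-*ˡ E cardsOf))))) ⟩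
        E * E * area S + E * (E * ∑∑ cardsOf) ≡⟨ factor E (area S) _ ⟩
        E * E * (area S + ∑∑ cardsOf)       ≡⟨ cong (E * E *_) (sym area′) ⟩
        E * E * area next ∎
        where
        open ≤-Reasoning
        factor : ∀ e a b → e * e * a + e * (e * b) ≡ e * e * (a + b)
        factor = solve-∀

    ∑∑⟦⟧≤ : (f : Fin n → Fin n → Bool) → ∑∑ (λ u v → ⟦ f u v ⟧) ≤ n * n
    ∑∑⟦⟧≤ f = ≤-trans (∑∑-mono (λ u v → ⟦⟧≤1 (f u v)))
      (≤-reflexive (trans (∑-cong (allFin n) (λ _ → trans (∑-const (allFin n) 1) (*-identityʳ _)))
                          (trans (∑-const (allFin n) _) (cong (λ k → k * k) (length-allFin n)))))

    -- E² · area never exceeds E² n², and every round raises it by more than n².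
    iterate : ∀ s {r} (S : State r) → E * E * (n * n) < E * E * area S + s * (n * n + 1) →
              ∃ λ r′ → Σ (State r′) λ S′ → (r′ ≤ partsBound s r) × (E * freshArea S′ ≤ n * n)
    iterate zero S budget = ⊥-elim (<⇒≱ budget (≤-trans (≤-reflexive (+-identityʳ _))
      (*-monoʳ-≤ (E * E) (∑∑⟦⟧≤ (λ u v → R S (P S u) (P S v))))))
    iterate (suc s) {r} S budget with E * freshArea S ≤? n * n
    ... | yes done = r , S , m≤m+n r _ , done
    ... | no  more =
      let r′ , S′ , r′≤ , done = iterate s next (<-≤-trans budget (≤-trans
            (≤-reflexive (sym (+-assoc (E * E * area S) _ _))) (+-monoˡ-≤ _ (grows (≰⇒> more)))))
      in  r′ , S′ , ≤-trans r′≤ (m≤n+m _ r) , done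
      where open Step S (rectangle S)

    trivial : State 1
    trivial = record
      { P = λ _ → zero ; R = λ _ _ → false
      ; sparse = ≤-trans (≤-reflexive (trans (cong (D *_) ∑∑0) (*-zeroʳ D))) z≤n }
      where
      ∑∑0 : ∑∑ {n} (λ _ _ → 0) ≡ 0
      ∑∑0 = trans (∑-cong (allFin n) (λ _ → ∑-zero (allFin n))) (∑-zero (allFin n))

    -- Density is contained in `lower-regular`: with X and Y the full classes it gives at least (1 -
    -- 1/E)|Pᵢ||Pⱼ|/D edges.
    record Partition (M : ℕ) : Set where
      field
        r     : ℕ
        r≤M   : r ≤ M
        P     : Fin n → Fin r
        dense : Fin r → Fin r → Bool
        lost  : D * ∑∑ (λ u v → ⟦ not (dense (P u) (P v)) ⟧ * ⟦ A u v ⟧) ≤ 2 * (n * n)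
        lower-regular : ∀ i j → dense i j ≡ true → (X Y : Fin n → Bool) →
          (∀ u → X u ≡ true → P u ≡ i) → (∀ u → Y u ≡ true → P u ≡ j) →
          E * (card X * card Y) ≤ E * (D * edges A X Y) + card (class P i) * card (class P j)

    -- Two losses of n²/D make up the bound in `lost`: the removed area holds at most n²/D edges by
    -- `sparse`, and the pairs still irregular have area at most n²/E, which D ≤ E turns into n²/D.
    regularity : D ≤ E → Partition (partsBound (suc (E * E)) 1)
    regularity D≤E =
      let r , S , r≤ , few = iterate (suc (E * E)) trivial budget
      in record
        { r = r ; r≤M = r≤ ; P = P S
        ; dense = dense S
        ; lost = lost S few
        ; lower-regular = λ i j dense-ij → regular⇒≤ (P S) i j (dense⇒regular S i j dense-ij)
        }
      where
      open ≤-Reasoning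
      budget : E * E * (n * n) < E * E * area trivial + suc (E * E) * (n * n + 1)
      budget = begin-strict
        E * E * (n * n)                     ≤⟨ m≤n+m _ (E * E) ⟩
        E * E + E * E * (n * n)             <⟨ m<n+m _ {n * n + 1} (m≤n+m 1 (n * n)) ⟩
        (n * n + 1) + (E * E + E * E * (n * n)) ≡⟨ regroup (E * E) (n * n) ⟩
        suc (E * E) * (n * n + 1)           ≤⟨ m≤n+m _ (E * E * area trivial) ⟩
        E * E * area trivial + suc (E * E) * (n * n + 1) ∎
        where
        regroup : ∀ e m → (m + 1) + (e + e * m) ≡ (m + 1) + e * (m + 1)
        regroup = solve-∀
      dense : ∀ {r} → State r → Fin r → Fin r → Bool
      dense S i j = not (R S i j) ∧ not (irregularᵇ (P S) i j)
      dense⇒regular : ∀ {r} (S : State r) i j → dense S i j ≡ true → irregularᵇ (P S) i j ≡ false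
      dense⇒regular S i j h with R S i j | irregularᵇ (P S) i j
      ... | false | false = refl
      split : ∀ r i a → ⟦ not (not r ∧ not i) ⟧ * a ≤ ⟦ r ⟧ * a + ⟦ not r ∧ i ⟧ * a
      split true  i     a = m≤m+n _ _
      split false true  a = ≤-refl
      split false false a = z≤n
      lost : ∀ {r} (S : State r) → E * freshArea S ≤ n * n →
             D * ∑∑ (λ u v → ⟦ not (dense S (P S u) (P S v)) ⟧ * ⟦ A u v ⟧) ≤ 2 * (n * n)
      lost S few = begin
        D * ∑∑ (λ u v → ⟦ not (dense S (P S u) (P S v)) ⟧ * ⟦ A u v ⟧)
          ≤⟨ *-monoʳ-≤ D (∑∑-mono (λ u v → split (R S (P S u) (P S v)) (irregularᵇ (P S) (P S u) (P S v)) ⟦ A u v ⟧)) ⟩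
        D * ∑∑ (λ u v → ⟦ R S (P S u) (P S v) ⟧ * ⟦ A u v ⟧ + ⟦ fresh S (P S u) (P S v) ⟧ * ⟦ A u v ⟧)
          ≡⟨ trans (cong (D *_) (∑∑-+ {n} _ _)) (*-distribˡ-+ D _ _) ⟩
        D * ∑∑ (λ u v → ⟦ R S (P S u) (P S v) ⟧ * ⟦ A u v ⟧) + D * ∑∑ (λ u v → ⟦ fresh S (P S u) (P S v) ⟧ * ⟦ A u v ⟧)
          ≤⟨ +-mono-≤ (≤-trans (sparse S) (∑∑⟦⟧≤ _)) (≤-trans (*-mono-≤ D≤E (∑∑-mono (λ u v →
               ≤-trans (*-monoʳ-≤ ⟦ fresh S (P S u) (P S v) ⟧ (⟦⟧≤1 (A u v))) (≤-reflexive (*-identityʳ _))))) few) ⟩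
        n * n + n * n
          ≡⟨ cong (n * n +_) (sym (+-identityʳ (n * n))) ⟩
        2 * (n * n) ∎

  -- Greedy embedding of a fixed graph into lower-regular pairs.

  removeFirst : {h : ℕ} → Graph (suc h) → Graph h
  removeFirst F = record
    { adj = λ i j → adj F (suc i) (suc j) ; sym = λ i j → Graph.sym F (suc i) (suc j) ; irref = λ i → irref F (suc i) }

  -- The 1 is the vertex just placed, which every later candidate set must avoid. The bound 2 D < x
  -- excludes y = 0, and then y + 1 ≤ 2 y.
  absorb-one : ∀ D x y → x ≤ 2 * D * (y + 1) → 2 * D < x → x ≤ 4 * D * y
  absorb-one D x zero    x≤ 2D<x = ⊥-elim (<⇒≱ 2D<x (≤-trans x≤ (≤-reflexive (*-identityʳ (2 * D)))))
  absorb-one D x (suc m) x≤ 2D<x = ≤-trans x≤ (≤-trans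
    (*-monoʳ-≤ (2 * D) (≤-trans (≤-reflexive (+-comm (suc m) 1)) (s≤s (m≤n+m (suc m) m))))
    (≤-reflexive (double D m)))
    where
    double : ∀ D m → 2 * D * (suc m + suc m) ≡ 4 * D * suc m
    double = solve-∀

  LowerRegular : {n r : ℕ} (G : Graph n) (D E : ℕ) (P : Fin n → Fin r) (i j : Fin r) → Set
  LowerRegular {n} G D E P i j = (X Y : Fin n → Bool) →
    (∀ u → X u ≡ true → P u ≡ i) → (∀ u → Y u ≡ true → P u ≡ j) →
    E * (card X * card Y) ≤ E * (D * edges (adj G) X Y) + card (class P i) * card (class P j)

  record Embedding {n h : ℕ} (G : Graph n) (F : Graph h) (C : Fin h → Fin n → Bool) : Set where
    field
      φ         : Fin h → Fin n
      φ∈C       : ∀ i → C i (φ i) ≡ true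
      injective : ∀ i j → φ i ≡ φ j → i ≡ j
      preserves : ∀ i j → adj F i j ≡ true → adj G (φ i) (φ j) ≡ true

  module Greedy {n : ℕ} (G : Graph n) (D E K h* : ℕ) (1≤D : 1 ≤ D) (E-large : 2 * (K * K) * h* < E)
                {r : ℕ} (P : Fin n → Fin r) where

    module Choose {h : ℕ} (h≤h* : h ≤ h*) (F : Graph (suc h)) (κ : ℕ) (κ≤K : κ ≤ K)
      (C : Fin (suc h) → Fin n → Bool) (c : Fin (suc h) → Fin r)
      (C⊆ : ∀ i u → C i u ≡ true → P u ≡ c i)
      (C-large : ∀ i → card (class P (c i)) ≤ κ * card (C i))
      (C≢∅ : ∀ i → 1 ≤ card (C i))
      (regular : ∀ i j → adj F i j ≡ true → LowerRegular G D E P (c i) (c j)) where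

      -- For j not adjacent to the first vertex the second conjunct holds trivially and the
      -- candidate set is kept whole. Adjacent and nonadjacent j can thus be treated alike.
      neighbours : Fin n → Fin h → Fin n → Bool
      neighbours v j w = C (suc j) w ∧ (not (adj F zero (suc j)) ∨ adj G v w)

      weak : Fin h → Fin n → Bool
      weak j v = C zero v ∧ ⌊ 2 * D * card (neighbours v j) <? card (C (suc j)) ⌋

      weak⊆ : ∀ j u → weak j u ≡ true → P u ≡ c zero
      weak⊆ j u w = C⊆ zero u (proj₁ (∧-true (C zero u) _ w))

      weak-edges : ∀ j → adj F zero (suc j) ≡ true →
        2 * (D * edges (adj G) (weak j) (C (suc j))) ≤ card (weak j) * card (C (suc j))
      weak-edges j adj-j = begin
        2 * (D * edges (adj G) (weak j) (C (suc j)))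
          ≡⟨ sym (*-assoc 2 D _) ⟩
        2 * D * edges (adj G) (weak j) (C (suc j))
          ≡⟨ sym (∑-*ˡ (2 * D) (allFin n) _) ⟩
        ∑ (allFin n) (λ u → 2 * D * ∑ (allFin n) (λ v → ⟦ weak j u ⟧ * (⟦ C (suc j) v ⟧ * ⟦ adj G u v ⟧)))
          ≤⟨ ∑-mono (allFin n) pointwise ⟩
        ∑ (allFin n) (λ u → ⟦ weak j u ⟧ * card (C (suc j)))
          ≡⟨ ∑-*ʳ _ (allFin n) _ ⟩
        card (weak j) * card (C (suc j)) ∎
        where
        open ≤-Reasoning
        common : ∀ u → ∑ (allFin n) (λ v → ⟦ C (suc j) v ⟧ * ⟦ adj G u v ⟧) ≡ card (neighbours u j)
        common u = ∑-cong (allFin n) (λ v → trans (sym (⟦∧⟧ (C (suc j) v) (adj G u v)))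
          (cong (λ b → ⟦ C (suc j) v ∧ (not b ∨ adj G u v) ⟧) (sym adj-j)))
        pointwise : ∀ u → 2 * D * ∑ (allFin n) (λ v → ⟦ weak j u ⟧ * (⟦ C (suc j) v ⟧ * ⟦ adj G u v ⟧)) ≤
                          ⟦ weak j u ⟧ * card (C (suc j))
        pointwise u rewrite ∑-*ˡ ⟦ weak j u ⟧ (allFin n) (λ v → ⟦ C (suc j) v ⟧ * ⟦ adj G u v ⟧) | common u
          with weak j u in eq
        ... | false = ≤-reflexive (*-zeroʳ (2 * D))
        ... | true  = subst₂ _≤_ (cong (2 * D *_) (sym (+-identityʳ _))) (sym (+-identityʳ _))
                        (<⇒≤ (⌊⌋-true (_ <? _) (proj₂ (∧-true (C zero u) _ eq))))

      not-weak : ∀ j → adj F zero (suc j) ≡ false → ∀ v → weak j v ≡ false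
      not-weak j nonadj v with C zero v
      ... | false = refl
      ... | true with 2 * D * card (neighbours v j) <? card (C (suc j))
      ... | no  _  = refl
      ... | yes lt = ⊥-elim (<⇒≱ lt (≤-trans (≤-reflexive all) (m≤n*m _ (2 * D))))
        where
        instance _ = >-nonZero (≤-trans 1≤D (m≤n*m D 2))
        all : card (C (suc j)) ≡ card (neighbours v j)
        all = ∑-cong (allFin n) (λ w → trans (sym (*-identityʳ _)) (trans (sym (⟦∧⟧ (C (suc j) w) true))
                (cong (λ b → ⟦ C (suc j) w ∧ (not b ∨ adj G v w) ⟧) (sym nonadj))))

      -- For adjacent j, a weak vertex sees at most half the density 1/D, so D e(W,C) ≤ |W||C|/2 for
      -- the weak set W. Lower regularity of W against C then forces E|W||C|/2 below the product of
      -- the class sizes, which is at most κ² |C₀||C|, and |C| cancels. For nonadjacent j nothing is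
      -- weak.
      weak-few : ∀ j → E * card (weak j) ≤ 2 * (κ * κ) * card (C zero)
      weak-few j = weak-few′ (adj F zero (suc j)) refl
        where
        weak-few′ : ∀ b → adj F zero (suc j) ≡ b → E * card (weak j) ≤ 2 * (κ * κ) * card (C zero)
        weak-few′ false eq = ≤-trans (≤-reflexive (trans (cong (E *_) (trans (∑-cong (allFin n) (λ v → cong ⟦_⟧ (not-weak j eq v)))
                      (∑-zero (allFin n)))) (*-zeroʳ E))) z≤n
        weak-few′ true eq = *-cancelʳ-≤ _ _ y (+-cancelˡ-≤ (E * (x * y)) _ _ (begin
          E * (x * y) + E * x * y                  ≡⟨ double E x y ⟩
          2 * (E * (x * y))                        ≤⟨ *-monoʳ-≤ 2 (regular zero (suc j) eq (weak j) (C (suc j)) (weak⊆ j) (C⊆ (suc j))) ⟩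
          2 * (E * (D * e) + a * b)                ≡⟨ regroup E (D * e) (a * b) ⟩
          E * (2 * (D * e)) + 2 * (a * b)          ≤⟨ +-mono-≤ (*-monoʳ-≤ E (weak-edges j eq))
                                                        (*-monoʳ-≤ 2 (*-mono-≤ (C-large zero) (C-large (suc j)))) ⟩
          E * (x * y) + 2 * (κ * z * (κ * y))      ≡⟨ cong (E * (x * y) +_) (collect κ z y) ⟩
          E * (x * y) + 2 * (κ * κ) * z * y        ∎))
          where
          open ≤-Reasoning
          x = card (weak j)
          y = card (C (suc j))
          z = card (C zero)
          a = card (class P (c zero))
          b = card (class P (c (suc j)))
          e = edges (adj G) (weak j) (C (suc j))
          instance _ = >-nonZero (C≢∅ (suc j))
          double : ∀ E x y → E * (x * y) + E * x * y ≡ 2 * (E * (x * y))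
          double = solve-∀
          regroup : ∀ E d m → 2 * (E * d + m) ≡ E * (2 * d) + 2 * m
          regroup = solve-∀
          collect : ∀ κ z y → 2 * (κ * z * (κ * y)) ≡ 2 * (κ * κ) * z * y
          collect = solve-∀

      -- By `weak-few` and E > 2 K² h*, the weak incidences over all later vertices number fewer
      -- than |C₀|. Averaging against the indicator of C₀ gives a v whose number of weak incidences
      -- lies strictly below that indicator: it lies in C₀ and is weak for no j.
      choice : ∃ λ v → (C zero v ≡ true) × (∀ j → card (C (suc j)) ≤ 2 * D * card (neighbours v j))
      choice = v , v∈C , λ j → ≮⇒≥ λ lt → <⇒≱ v-good (≤-trans (⟦⟧≤1 (C zero v))
        (≤-trans (≤-reflexive (cong ⟦_⟧ (sym (cong₂ _∧_ v∈C (true-⌊⌋ (_ <? _) lt)))))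
                 (∑-term (λ j → ⟦ weak j v ⟧) j)))
        where
        open ≤-Reasoning
        z = card (C zero)
        instance _ = >-nonZero (C≢∅ zero)
        total : ∑ (allFin n) (λ v → ∑ (allFin h) (λ j → ⟦ weak j v ⟧)) < z
        total = *-cancelˡ-< E _ _ (begin-strict
          E * ∑ (allFin n) (λ v → ∑ (allFin h) (λ j → ⟦ weak j v ⟧)) ≡⟨ cong (E *_) (∑-swap (allFin n) (allFin h) _) ⟩
          E * ∑ (allFin h) (λ j → card (weak j))  ≡⟨ sym (∑-*ˡ E (allFin h) _) ⟩
          ∑ (allFin h) (λ j → E * card (weak j))  ≤⟨ ∑-mono (allFin h) weak-few ⟩
          ∑ (allFin h) (λ _ → 2 * (κ * κ) * z)    ≡⟨ trans (∑-const (allFin h) _) (cong (_* (2 * (κ * κ) * z)) (length-allFin h)) ⟩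
          h * (2 * (κ * κ) * z)                   ≡⟨ rotate h (2 * (κ * κ)) z ⟩
          2 * (κ * κ) * h * z                     ≤⟨ *-monoˡ-≤ z (*-mono-≤ (*-monoʳ-≤ 2 (*-mono-≤ κ≤K κ≤K)) h≤h*) ⟩
          2 * (K * K) * h* * z                    <⟨ *-monoˡ-< z E-large ⟩
          E * z                                   ∎)
          where
          rotate : ∀ h k z → h * (k * z) ≡ k * h * z
          rotate = solve-∀
        v,good = ∑-<⇒∃ (allFin n) _ _ total
        v = proj₁ v,good
        v-good = proj₂ v,good
        v∈C : C zero v ≡ true
        v∈C = positive (C zero v) v-good
          where
          positive : ∀ b {m} → m < ⟦ b ⟧ → b ≡ true
          positive true _ = refl

    -- Induction on the number of vertices of F, where 1/κ bounds from below the share of its class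
    -- that each candidate set retains. One step costs a factor 2 D for passing to neighbours and a
    -- factor 2 for deleting the chosen vertex, so κ becomes 4 D κ; the hypothesis κ (4 D)^h ≤ K is
    -- preserved by this exchange.
    embed : ∀ {h} → h ≤ h* → (F : Graph h) (κ : ℕ) → κ * (4 * D) ^ h ≤ K →
      (C : Fin h → Fin n → Bool) (c : Fin h → Fin r) →
      (∀ i u → C i u ≡ true → P u ≡ c i) →
      (∀ i → card (class P (c i)) ≤ κ * card (C i)) →
      (∀ i → 2 * D * K < card (class P (c i))) →
      (∀ i j → adj F i j ≡ true → LowerRegular G D E P (c i) (c j)) →
      Embedding G F C
    embed {zero} _ F κ _ C c _ _ _ _ =
      record { φ = λ () ; φ∈C = λ () ; injective = λ () ; preserves = λ () }
    embed {suc h} h<h* F κ κ-small C c C⊆ C-large class-large regular =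
      extend choice
      where
      4D = 4 * D
      instance
        _ = >-nonZero 1≤D
        4D≢0 : NonZero 4D
        4D≢0 = m*n≢0 4 D
      κ≤K : κ ≤ K
      κ≤K = ≤-trans (m≤m*n κ (4D ^ suc h) {{m^n≢0 4D (suc h)}}) κ-small
      -- As κ ≤ K, a class with more than 2 D K vertices leaves more than 2 D candidates, which is
      -- what `absorb-one` requires.
      C>2D : ∀ i → 2 * D < card (C i)
      C>2D i = *-cancelˡ-< κ _ _ (≤-<-trans (≤-trans (*-monoˡ-≤ (2 * D) κ≤K) (≤-reflexive (*-comm K (2 * D))))
                 (<-≤-trans (class-large i) (C-large i)))
      C≢∅ : ∀ i → 1 ≤ card (C i)
      C≢∅ i = ≤-trans (s≤s z≤n) (C>2D i)
      open Choose (≤-trans (n≤1+n h) h<h*) F κ κ≤K C c C⊆ C-large C≢∅ regular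
      extend : (∃ λ v → (C zero v ≡ true) × (∀ j → card (C (suc j)) ≤ 2 * D * card (neighbours v j))) → Embedding G F C
      extend (v , v∈C , v-good) =
        record { φ = φ′ ; φ∈C = φ′∈C ; injective = φ′-injective ; preserves = φ′-preserves }
        where
        C′ : Fin h → Fin n → Bool
        C′ j w = neighbours v j w ∧ not ⌊ v Fin.≟ w ⌋
        neighbours≤ : ∀ j → card (neighbours v j) ≤ card (C′ j) + 1
        neighbours≤ j = ≤-trans (∑-mono (allFin n) (λ w → split (neighbours v j w) ⌊ v Fin.≟ w ⌋))
          (≤-reflexive (trans (∑-+ (allFin n) _ _) (cong (card (C′ j) +_) (∑-δ v (λ _ → 1)))))
          where
          split : ∀ a b → ⟦ a ⟧ ≤ ⟦ a ∧ not b ⟧ + ⟦ b ⟧ * 1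
          split true  true  = ≤-refl
          split true  false = ≤-refl
          split false b     = z≤n
        C≤ : ∀ j → card (C (suc j)) ≤ 4D * card (C′ j)
        C≤ j = absorb-one D _ _ (≤-trans (v-good j) (*-monoʳ-≤ (2 * D) (neighbours≤ j))) (C>2D (suc j))
        C′⊆C : ∀ j w → C′ j w ≡ true → C (suc j) w ≡ true
        C′⊆C j w w∈ = proj₁ (∧-true (C (suc j) w) _ (proj₁ (∧-true (neighbours v j w) _ w∈)))
        open Embedding (embed (≤-trans (n≤1+n h) h<h*) (removeFirst F) (κ * 4D)
          (≤-trans (≤-reflexive (*-assoc κ 4D (4D ^ h))) κ-small) C′ (c ∘ suc)
          (λ j w w∈ → C⊆ (suc j) w (C′⊆C j w w∈))
          (λ j → ≤-trans (C-large (suc j)) (≤-trans (*-monoʳ-≤ κ (C≤ j)) (≤-reflexive (sym (*-assoc κ 4D _)))))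
          (class-large ∘ suc)
          (λ i j → regular (suc i) (suc j)))
        φ′ : Fin (suc h) → Fin n
        φ′ zero    = v
        φ′ (suc j) = φ j
        φ′∈C : ∀ i → C i (φ′ i) ≡ true
        φ′∈C zero    = v∈C
        φ′∈C (suc j) = C′⊆C j (φ j) (φ∈C j)
        v≢φ : ∀ j → v ≢ φ j
        v≢φ j v≡φ with proj₂ (∧-true (neighbours v j (φ j)) _ (φ∈C j))
        ... | q rewrite true-⌊⌋ (v Fin.≟ φ j) v≡φ = true≢false (sym q)
        φ′-injective : ∀ i j → φ′ i ≡ φ′ j → i ≡ j
        φ′-injective zero    zero    _  = refl
        φ′-injective zero    (suc j) eq = ⊥-elim (v≢φ j eq)
        φ′-injective (suc i) zero    eq = ⊥-elim (v≢φ i (sym eq))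
        φ′-injective (suc i) (suc j) eq = cong suc (injective i j eq)
        v~φ : ∀ j → adj F zero (suc j) ≡ true → adj G v (φ j) ≡ true
        v~φ j adj-j with proj₂ (∧-true (C (suc j) (φ j)) _ (proj₁ (∧-true (neighbours v j (φ j)) _ (φ∈C j))))
        ... | q rewrite adj-j = q
        φ′-preserves : ∀ i j → adj F i j ≡ true → adj G (φ′ i) (φ′ j) ≡ true
        φ′-preserves zero    zero    loop = ⊥-elim (true≢false (trans (sym loop) (irref F zero)))
        φ′-preserves zero    (suc j) e = v~φ j e
        φ′-preserves (suc i) zero    e = trans (Graph.sym G (φ i) v) (v~φ i (trans (Graph.sym F zero (suc i)) e))
        φ′-preserves (suc i) (suc j) e = preserves i j e

  -- The graph B_χ on a finite index type, and disjoint placement of its copies.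

  any⁺ : {A : Set} (p : A → Bool) {x : A} {xs : List A} → x ∈ xs → p x ≡ true → any p xs ≡ true
  any⁺ p (here refl) px rewrite px = refl
  any⁺ p {xs = y ∷ _} (there x∈) px with p y
  ... | true  = refl
  ... | false = any⁺ p x∈ px

  any⁻ : {A : Set} (p : A → Bool) (xs : List A) → any p xs ≡ true → ∃ λ x → p x ≡ true
  any⁻ p (x ∷ xs) h with p x in eq
  ... | true  = x , eq
  ... | false = any⁻ p xs h

  any≤∑ : {A : Set} (p : A → Bool) (xs : List A) → ⟦ any p xs ⟧ ≤ ∑ xs (⟦_⟧ ∘ p)
  any≤∑ p []       = z≤n
  any≤∑ p (x ∷ xs) with p x
  ... | true  = s≤s z≤n
  ... | false = any≤∑ p xs

  ∑≤any : {A : Set} {n : ℕ} (f : A → Fin n) → Injective _≡_ _≡_ f → (v : Fin n) {xs : List A} → Unique xs →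
          ∑ xs (λ x → ⟦ ⌊ f x Fin.≟ v ⌋ ⟧) ≤ ⟦ any (λ x → ⌊ f x Fin.≟ v ⌋) xs ⟧
  ∑≤any f f-inj v []                       = z≤n
  ∑≤any f f-inj v {x ∷ xs} (x≢ ∷ unique) with f x Fin.≟ v
  ... | no  _    = ∑≤any f f-inj v unique
  ... | yes fx≡v = ≤-reflexive (cong suc (none xs x≢))
    where
    none : ∀ ys → All (x ≢_) ys → ∑ ys (λ y → ⟦ ⌊ f y Fin.≟ v ⌋ ⟧) ≡ 0
    none []       []          = refl
    none (y ∷ ys) (x≢y ∷ x≢) with f y Fin.≟ v
    ... | yes fy≡v = ⊥-elim (x≢y (f-inj (trans fx≡v (sym fy≡v))))
    ... | no  _    = none ys x≢

  length-cartesianProduct : {A B : Set} (xs : List A) (ys : List B) →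
                            length (cartesianProduct xs ys) ≡ length xs * length ys
  length-cartesianProduct []       ys = refl
  length-cartesianProduct (x ∷ xs) ys = trans (length-++ (map (x ,_) ys))
    (cong₂ _+_ (length-map (x ,_) ys) (length-cartesianProduct xs ys))

  module Bottle (k a b : ℕ) where

    B : Set
    B = BV k a b

    vertices : List B
    vertices = BVlist k a b

    order : ℕ
    order = vB k a b

    encode : B → Fin order
    encode x = join a ((k ∸ 1) * b) (Sum.map₂ (Product.uncurry combine) x)

    decode : Fin order → B
    decode i = Sum.map₂ (remQuot {k ∸ 1} b) (splitAt a i)

    decode-encode : ∀ x → decode (encode x) ≡ x
    decode-encode x = trans (cong (Sum.map₂ (remQuot {k ∸ 1} b)) (splitAt-join a ((k ∸ 1) * b) (Sum.map₂ (Product.uncurry combine) x))) (inverse x)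
      where
      inverse : ∀ x → Sum.map₂ (remQuot {k ∸ 1} b) (Sum.map₂ (Product.uncurry combine) x) ≡ x
      inverse (inj₁ _)       = refl
      inverse (inj₂ (i , j)) = cong inj₂ (remQuot-combine i j)

    encode-injective : Injective _≡_ _≡_ encode
    encode-injective {x} {y} eq = trans (sym (decode-encode x)) (trans (cong decode eq) (decode-encode y))

    graph : Graph order
    graph = record
      { adj   = λ i j → adjB {k} {a} {b} (decode i) (decode j)
      ; sym   = λ i j → adjB-sym (decode i) (decode j)
      ; irref = λ i → adjB-irrefl (decode i)
      }
      where
      adjB-sym : ∀ x y → adjB {k} {a} {b} x y ≡ adjB {k} {a} {b} y x
      adjB-sym (inj₁ _)       (inj₁ _)       = refl
      adjB-sym (inj₁ _)       (inj₂ _)       = refl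
      adjB-sym (inj₂ _)       (inj₁ _)       = refl
      adjB-sym (inj₂ (i , _)) (inj₂ (j , _)) with i Fin.≟ j | j Fin.≟ i
      ... | yes _   | yes _   = refl
      ... | no  _   | no  _   = refl
      ... | yes i≡j | no  j≢i = ⊥-elim (j≢i (sym i≡j))
      ... | no  i≢j | yes j≡i = ⊥-elim (i≢j (sym j≡i))
      adjB-irrefl : ∀ x → adjB {k} {a} {b} x x ≡ false
      adjB-irrefl (inj₁ _)       = refl
      adjB-irrefl (inj₂ (i , _)) = cong not (true-⌊⌋ (i Fin.≟ i) refl)

    ∈-vertices : ∀ x → x ∈ vertices
    ∈-vertices (inj₁ i)       = ∈-++⁺ˡ (∈-map⁺ inj₁ (∈-allFin i))
    ∈-vertices (inj₂ (i , j)) =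
      ∈-++⁺ʳ (map inj₁ (allFin a)) (∈-map⁺ inj₂ (∈-cartesianProduct⁺ (∈-allFin i) (∈-allFin j)))

    vertices-unique : Unique vertices
    vertices-unique = Unique.++⁺ (Unique.map⁺ inj₁-injective (Unique.allFin⁺ a))
      (Unique.map⁺ inj₂-injective (Unique.cartesianProduct⁺ (Unique.allFin⁺ (k ∸ 1)) (Unique.allFin⁺ b)))
      (λ (p , q) → inj₁≢inj₂ (trans (sym (proj₂ (proj₂ (∈-map⁻ inj₁ p)))) (proj₂ (proj₂ (∈-map⁻ inj₂ q)))))
      where
      inj₁≢inj₂ : ∀ {i : Fin a} {y : Fin (k ∸ 1) × Fin b} → _≢_ {A = B} (inj₁ i) (inj₂ y)
      inj₁≢inj₂ ()

    length-vertices : length vertices ≡ order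
    length-vertices = trans (length-++ (map inj₁ (allFin a)))
      (cong₂ _+_ (trans (length-map inj₁ (allFin a)) (length-allFin a))
        (trans (length-map inj₂ (cartesianProduct (allFin (k ∸ 1)) (allFin b)))
          (trans (length-cartesianProduct (allFin (k ∸ 1)) (allFin b)) (cong₂ _*_ (length-allFin (k ∸ 1)) (length-allFin b)))))

    -- The number of vertices that a copy of type c takes from class i.
    load : {r : ℕ} → (B → Fin r) → Fin r → ℕ
    load c i = ∑ vertices (λ x → ⟦ ⌊ c x Fin.≟ i ⌋ ⟧)

    image : {n : ℕ} → (B → Fin n) → Fin n → Bool
    image f v = any (λ x → ⌊ f x Fin.≟ v ⌋) vertices

    image⁺ : {n : ℕ} (f : B → Fin n) (x : B) → image f (f x) ≡ true
    image⁺ f x = any⁺ (λ y → ⌊ f y Fin.≟ f x ⌋) (∈-vertices x) (true-⌊⌋ (f x Fin.≟ f x) refl)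

    image⁻ : {n : ℕ} (f : B → Fin n) (v : Fin n) → image f v ≡ true → ∃ λ x → f x ≡ v
    image⁻ f v h with any⁻ _ vertices h
    ... | x , fx≟v = x , ⌊⌋-true (f x Fin.≟ v) fx≟v

    -- Double counting of the pairs (x, v) with f x = v.
    ∑-preimages : {n : ℕ} (f : B → Fin n) (g : Fin n → ℕ) →
      ∑ (allFin n) (λ v → ∑ vertices (λ x → ⟦ ⌊ f x Fin.≟ v ⌋ ⟧) * g v) ≡ ∑ vertices (g ∘ f)
    ∑-preimages {n} f g = trans (∑-cong (allFin n) (λ v → sym (∑-*ʳ (g v) vertices _)))
      (trans (∑-swap (allFin n) vertices _) (∑-cong vertices (λ x → ∑-δ (f x) g)))

    order≤card-image : {n : ℕ} (f : B → Fin n) → Injective _≡_ _≡_ f → order ≤ card (image f)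
    order≤card-image {n} f f-inj = begin
      order                           ≡⟨ sym (trans (∑-const vertices 1) (trans (*-identityʳ _) length-vertices)) ⟩
      ∑ vertices (λ _ → 1)            ≡⟨ sym (∑-preimages f (λ _ → 1)) ⟩
      ∑ (allFin n) (λ v → ∑ vertices (λ x → ⟦ ⌊ f x Fin.≟ v ⌋ ⟧) * 1)
                                      ≤⟨ ∑-mono (allFin n) (λ v → ≤-trans (≤-reflexive (*-identityʳ _)) (∑≤any f f-inj v vertices-unique)) ⟩
      card (image f)                  ∎
      where open ≤-Reasoning

    card-class-image : {n r : ℕ} (P : Fin n → Fin r) (f : B → Fin n) (i : Fin r) →
      ∑ (allFin n) (λ v → ⟦ class P i v ⟧ * ⟦ image f v ⟧) ≤ load (P ∘ f) i
    card-class-image {n} P f i = ≤-trans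
      (∑-mono (allFin n) (λ v → ≤-trans (*-monoʳ-≤ ⟦ class P i v ⟧ (any≤∑ (λ x → ⌊ f x Fin.≟ v ⌋) vertices))
                                        (≤-reflexive (*-comm ⟦ class P i v ⟧ _))))
      (≤-reflexive (∑-preimages f (λ v → ⟦ class P i v ⟧)))

    module Tiling {n : ℕ} (G : Graph n) (D E K z : ℕ) (1≤D : 1 ≤ D) (E-large : 2 * (K * K) * order < E)
                  (K-large : suc z * (4 * D) ^ order ≤ K) {r : ℕ} (P : Fin n → Fin r) where

      open Greedy G D E K order 1≤D E-large P

      record Admissible (c : B → Fin r) : Set where
        field
          class-large : ∀ x → 2 * D * K < card (class P (c x))
          regular     : ∀ x y → adjB {k} {a} {b} x y ≡ true → LowerRegular G D E P (c x) (c y)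

      record Realisation (cs : List (B → Fin r)) : Set where
        field
          tiles    : List (Copy k a b G)
          isTiling : IsTiling k a b G tiles
          covering : order * length cs ≤ card (covers tiles)
          used     : ∀ i → ∑ (allFin n) (λ v → ⟦ class P i v ⟧ * ⟦ covers tiles v ⟧) ≤ ∑ cs (λ c → load c i)

      covers-lookup : (L : List (Copy k a b G)) (j : Fin (length L)) (y : B) →
                      covers L (hmap (hom (lookup L j)) y) ≡ true
      covers-lookup (t ∷ L) zero    y = cong (_∨ covers L (hmap (hom t) y)) (image⁺ (hmap (hom t)) y)
      covers-lookup (t ∷ L) (suc j) y with image (hmap (hom t)) (hmap (hom (lookup L j)) y)
      ... | true  = refl
      ... | false = covers-lookup L j y

      tiling-∷ : (t : Copy k a b G) (L : List (Copy k a b G)) → IsTiling k a b G L →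
                 (∀ x → covers L (hmap (hom t) x) ≡ false) → IsTiling k a b G (t ∷ L)
      tiling-∷ t L L-tiling fresh zero    zero    i≢j x y _  = i≢j refl
      tiling-∷ t L L-tiling fresh zero    (suc j) _   x y eq =
        true≢false (trans (sym (covers-lookup L j y)) (trans (cong (covers L) (sym eq)) (fresh x)))
      tiling-∷ t L L-tiling fresh (suc i) zero    _   x y eq =
        true≢false (trans (sym (covers-lookup L i x)) (trans (cong (covers L) eq) (fresh y)))
      tiling-∷ t L L-tiling fresh (suc i) (suc j) i≢j x y eq = L-tiling i j (λ i≡j → i≢j (cong suc i≡j)) x y eq

      -- The tail is placed first. By `used` and the budget it occupies at most a share z/Z of each
      -- class, so a share 1/Z is free for the next copy, and `embed` starts with κ = Z inside the
      -- free part. `K-large` is its hypothesis for this κ.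
      realise : (cs : List (B → Fin r)) → All Admissible cs →
                (∀ i → suc z * ∑ cs (λ c → load c i) ≤ z * card (class P i)) → Realisation cs
      realise [] [] _ = record
        { tiles = [] ; isTiling = λ () ; covering = ≤-trans (≤-reflexive (*-zeroʳ order)) z≤n
        ; used = λ i → ≤-reflexive (trans (∑-cong (allFin n) (λ v → *-zeroʳ ⟦ class P i v ⟧)) (∑-zero (allFin n))) }
      realise (c ∷ cs) (c-ok ∷ cs-ok) budget =
        extend (realise cs cs-ok (λ i → ≤-trans (*-monoʳ-≤ (suc z) (m≤n+m _ (load c i))) (budget i)))
        where
        open Admissible c-ok
        extend : Realisation cs → Realisation (c ∷ cs)
        extend ρ = place (embed ≤-refl graph (suc z) K-large C (c ∘ decode) C⊆ C-large (class-large ∘ decode)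
                           (λ i j → regular (decode i) (decode j)))
          where
          open Realisation ρ
          C : Fin order → Fin n → Bool
          C j v = class P (c (decode j)) v ∧ not (covers tiles v)
          C⊆ : ∀ j v → C j v ≡ true → P v ≡ c (decode j)
          C⊆ j v v∈ = ⌊⌋-true (_ Fin.≟ _) (proj₁ (∧-true (class P (c (decode j)) v) _ v∈))
          C-large : ∀ j → card (class P (c (decode j))) ≤ suc z * card (C j)
          C-large j = +-cancelˡ-≤ (z * m) _ _ (begin
            z * m + m                     ≡⟨ +-comm (z * m) m ⟩
            suc z * m                     ≡⟨ cong (suc z *_) (trans (∑-cong (allFin n) (λ v →
                                               split (class P i v) (covers tiles v))) (∑-+ (allFin n) _ _)) ⟩
            suc z * (u + card (C j))      ≡⟨ *-distribˡ-+ (suc z) u _ ⟩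
            suc z * u + suc z * card (C j) ≤⟨ +-monoˡ-≤ _ (≤-trans (*-monoʳ-≤ (suc z) (≤-trans (used i) (m≤n+m _ (load c i)))) (budget i)) ⟩
            z * m + suc z * card (C j)    ∎)
            where
            open ≤-Reasoning
            i = c (decode j)
            m = card (class P i)
            u = ∑ (allFin n) (λ v → ⟦ class P i v ⟧ * ⟦ covers tiles v ⟧)
            split : ∀ x y → ⟦ x ⟧ ≡ ⟦ x ⟧ * ⟦ y ⟧ + ⟦ x ∧ not y ⟧
            split true  true  = refl
            split true  false = refl
            split false y     = refl
          place : Embedding G graph C → Realisation (c ∷ cs)
          place e = record
            { tiles    = tile ∷ tiles
            ; isTiling = tiling-∷ tile tiles isTiling fresh
            ; covering = ≤-trans (≤-reflexive (*-suc order (length cs)))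
                (≤-trans (+-mono-≤ (order≤card-image f f-injective) covering)
                         (≤-reflexive (trans (sym (∑-+ (allFin n) _ _)) (∑-cong (allFin n) (λ v → sym (⟦covers⟧ v))))))
            ; used     = λ i → ≤-trans
                (≤-reflexive (trans (∑-cong (allFin n) (λ v →
                   trans (cong (⟦ class P i v ⟧ *_) (⟦covers⟧ v)) (*-distribˡ-+ ⟦ class P i v ⟧ _ _))) (∑-+ (allFin n) _ _)))
                (+-mono-≤ (≤-trans (card-class-image P f i)
                             (≤-reflexive (∑-cong vertices (λ x → cong (λ j → ⟦ ⌊ j Fin.≟ i ⌋ ⟧) (P∘f x))))) (used i))
            }
            where
            open Embedding e
            f : B → Fin n
            f x = φ (encode x)
            f-injective : Injective _≡_ _≡_ f
            f-injective eq = encode-injective (injective _ _ eq)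
            tile : Copy k a b G
            tile = record
              { hom = record
                { hmap = f
                ; pres = λ x y x~y → preserves (encode x) (encode y)
                    (trans (cong₂ (adjB {k} {a} {b}) (decode-encode x) (decode-encode y)) x~y) }
              ; inj = f-injective }
            P∘f : ∀ x → P (f x) ≡ c x
            P∘f x = trans (C⊆ (encode x) (f x) (φ∈C (encode x))) (cong c (decode-encode x))
            fresh : ∀ x → covers tiles (f x) ≡ false
            fresh x = not-true (covers tiles (f x)) (proj₂ (∧-true (class P (c (decode (encode x))) (f x)) _ (φ∈C (encode x))))
              where
              not-true : ∀ b → not b ≡ true → b ≡ false
              not-true false _ = refl
            ⟦covers⟧ : ∀ v → ⟦ covers (tile ∷ tiles) v ⟧ ≡ ⟦ image f v ⟧ + ⟦ covers tiles v ⟧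
            ⟦covers⟧ v = ⟦∨⟧-disjoint (image f v) (covers tiles v) λ v∈ →
              let x , fx≡v = image⁻ f v v∈ in trans (cong (covers tiles) (sym fx≡v)) (fresh x)

  -- Cleaning: the approximation given by the partition.

  -- Edges at bad vertices are kept: then every degree is nearly preserved, and homomorphisms
  -- meeting the few bad vertices carry little weight.
  module Cleaning {n : ℕ} (G : Graph n) (D E Z s M : ℕ) (D-large : D ≡ 8 * (Z * Z))
                  (1≤n : 1 ≤ n) (n-large : 2 * Z * (M * s) ≤ n)
                  (𝒫 : Regularity.Partition (adj G) D E M) where

    open Regularity.Partition 𝒫

    -- `dense` concerns ordered pairs of classes; requiring both orders makes the cleaned adjacency
    -- symmetric.
    keep : Fin n → Fin n → Bool
    keep u v = dense (P u) (P v) ∧ dense (P v) (P u)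

    loss : Fin n → ℕ
    loss u = ∑ (allFin n) (λ v → ⟦ not (keep u v) ⟧ * ⟦ adj G u v ⟧)

    -- Two defects make a vertex bad: more than n/Z of its edges lie outside kept pairs, or its
    -- class has at most s vertices and is too small to embed into. In use s = 2 D K, the threshold
    -- in `Admissible`.
    heavy small bad : Fin n → Bool
    heavy u = ⌊ n <? loss u * Z ⌋
    small u = not ⌊ s <? card (class P (P u)) ⌋
    bad u   = heavy u ∨ small u

    cleaned : Graph n
    cleaned = record
      { adj   = λ u v → adj G u v ∧ ((bad u ∨ bad v) ∨ keep u v)
      ; sym   = λ u v → cong₂ _∧_ (Graph.sym G u v)
                  (cong₂ _∨_ (∨-comm (bad u) (bad v)) (∧-comm (dense (P u) (P v)) _))
      ; irref = λ v → cong (_∧ ((bad v ∨ bad v) ∨ keep v v)) (irref G v)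
      }

    cleaned⊆ : ∀ u v → adj cleaned u v ≡ true → adj G u v ≡ true
    cleaned⊆ u v h = proj₁ (∧-true (adj G u v) _ h)

    not-bad⇒large : ∀ u → bad u ≡ false → s < card (class P (P u))
    not-bad⇒large u h with heavy u | s <? card (class P (P u))
    ... | false | yes lt = lt

    cleaned⇒regular : ∀ u v → adj cleaned u v ≡ true → bad u ≡ false → bad v ≡ false →
                      LowerRegular G D E P (P u) (P v)
    cleaned⇒regular u v h u-good v-good =
      lower-regular (P u) (P v) (proj₁ (∧-true (dense (P u) (P v)) _ kept))
      where
      kept : keep u v ≡ true
      kept = trans (cong₂ (λ x y → (x ∨ y) ∨ keep u v) (sym u-good) (sym v-good)) (proj₂ (∧-true (adj G u v) _ h))

    deg≡ : (F : Graph n) (v : Fin n) → deg F v ≡ card (adj F v)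
    deg≡ F v = countL-∑ (adj F v) (allFin n)

    not-bad⇒loss : ∀ u → bad u ≡ false → loss u * Z ≤ n
    not-bad⇒loss u h with n <? loss u * Z
    ... | no ≮ = ≮⇒≥ ≮

    degree : ∀ v → Z * deg G v ≤ Z * deg cleaned v + n
    degree v = by-badness (bad v) refl
      where
      open ≤-Reasoning
      by-badness : ∀ b → bad v ≡ b → Z * deg G v ≤ Z * deg cleaned v + n
      by-badness true eq = begin
        Z * deg G v              ≡⟨ cong (Z *_) (trans (deg≡ G v) (trans (∑-cong (allFin n) all-kept) (sym (deg≡ cleaned v)))) ⟩
        Z * deg cleaned v        ≤⟨ m≤m+n _ n ⟩
        Z * deg cleaned v + n    ∎
        where
        all-kept : ∀ w → ⟦ adj G v w ⟧ ≡ ⟦ adj G v w ∧ ((bad v ∨ bad w) ∨ keep v w) ⟧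
        all-kept w rewrite eq with adj G v w
        ... | true  = refl
        ... | false = refl
      by-badness false eq = begin
        Z * deg G v                       ≡⟨ cong (Z *_) (deg≡ G v) ⟩
        Z * card (adj G v)                ≤⟨ *-monoʳ-≤ Z (≤-trans (∑-mono (allFin n) (λ w → split (adj G v w) (bad v ∨ bad w) (keep v w)))
                                               (≤-reflexive (∑-+ (allFin n) _ _))) ⟩
        Z * (card (adj cleaned v) + loss v) ≡⟨ *-distribˡ-+ Z _ _ ⟩
        Z * card (adj cleaned v) + Z * loss v ≤⟨ +-mono-≤ (≤-reflexive (cong (Z *_) (sym (deg≡ cleaned v))))
                                                   (≤-trans (≤-reflexive (*-comm Z _)) (not-bad⇒loss v eq)) ⟩
        Z * deg cleaned v + n             ∎
        where
        split : ∀ e b k → ⟦ e ⟧ ≤ ⟦ e ∧ (b ∨ k) ⟧ + ⟦ not k ⟧ * ⟦ e ⟧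
        split false b     k     = z≤n
        split true  true  k     = s≤s z≤n
        split true  false true  = ≤-refl
        split true  false false = ≤-refl

    lostAt : Fin n → Fin n → ℕ
    lostAt u v = ⟦ not (dense (P u) (P v)) ⟧ * ⟦ adj G u v ⟧

    -- An edge outside kept pairs fails in at least one of the two orders, so the loss of the
    -- partition is counted twice.
    total-loss : D * ∑ (allFin n) loss ≤ 4 * (n * n)
    total-loss = begin
      D * ∑ (allFin n) loss                      ≤⟨ *-monoʳ-≤ D (∑∑-mono {n} pointwise) ⟩
      D * ∑∑ (λ u v → lostAt u v + lostAt v u)    ≡⟨ cong (D *_) (trans (∑∑-+ {n} lostAt _)
                                                     (cong (∑∑ lostAt +_) (∑-swap (allFin n) (allFin n) (λ u v → lostAt v u)))) ⟩
      D * (∑∑ lostAt + ∑∑ lostAt)                ≡⟨ *-distribˡ-+ D _ _ ⟩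
      D * ∑∑ lostAt + D * ∑∑ lostAt              ≤⟨ +-mono-≤ lost lost ⟩
      2 * (n * n) + 2 * (n * n)                  ≡⟨ four (n * n) ⟩
      4 * (n * n)                                ∎
      where
      open ≤-Reasoning
      four : ∀ x → 2 * x + 2 * x ≡ 4 * x
      four = solve-∀
      pointwise : ∀ u v → ⟦ not (keep u v) ⟧ * ⟦ adj G u v ⟧ ≤ lostAt u v + lostAt v u
      pointwise u v rewrite Graph.sym G v u with dense (P u) (P v) | dense (P v) (P u)
      ... | true  | true  = z≤n
      ... | true  | false = ≤-refl
      ... | false | _     = m≤m+n _ _

    -- Markov's inequality. With D = 8 Z² the total loss is at most n²/(2 Z²), and each heavy vertex
    -- accounts for more than n/Z of it. This takes half of the n/Z bad vertices allowed; the other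
    -- half is left to the small classes.
    few-heavy : 2 * Z * card heavy ≤ n
    few-heavy = *-cancelʳ-≤ _ _ n (begin
      2 * Z * card heavy * n          ≡⟨ *-assoc (2 * Z) (card heavy) n ⟩
      2 * Z * (card heavy * n)        ≡⟨ cong (2 * Z *_) (sym (∑-*ʳ n (allFin n) _)) ⟩
      2 * Z * ∑ (allFin n) (λ u → ⟦ heavy u ⟧ * n)
                                      ≤⟨ *-monoʳ-≤ (2 * Z) (∑-mono (allFin n) pointwise) ⟩
      2 * Z * ∑ (allFin n) (λ u → loss u * Z) ≡⟨ cong (2 * Z *_) (∑-*ʳ Z (allFin n) loss) ⟩
      2 * Z * (L * Z)                 ≤⟨ *-cancelˡ-≤ 4 (begin
         4 * (2 * Z * (L * Z))        ≡⟨ regroup Z L ⟩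
         8 * (Z * Z) * L              ≡⟨ cong (_* L) (sym D-large) ⟩
         D * L                        ≤⟨ total-loss ⟩
         4 * (n * n)                  ∎) ⟩
      n * n                           ∎)
      where
      open ≤-Reasoning
      instance _ = >-nonZero 1≤n
      L = ∑ (allFin n) loss
      regroup : ∀ Z L → 4 * (2 * Z * (L * Z)) ≡ 8 * (Z * Z) * L
      regroup = solve-∀
      pointwise : ∀ u → ⟦ heavy u ⟧ * n ≤ loss u * Z
      pointwise u with n <? loss u * Z
      ... | yes lt = ≤-trans (≤-reflexive (+-identityʳ n)) (<⇒≤ lt)
      ... | no  _  = z≤n

    few-small : card small ≤ M * s
    few-small = begin
      card small                                      ≡⟨ ∑-fibre P (λ i _ → ⟦ smallClass i ⟧) ⟩
      ∑ (allFin r) (λ i → ∑ (allFin n) (λ u → ⟦ class P i u ⟧ * ⟦ smallClass i ⟧))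
                                                      ≤⟨ ∑-mono (allFin r) (λ i → ≤-trans (≤-reflexive (∑-*ʳ ⟦ smallClass i ⟧ (allFin n) _)) (bound i)) ⟩
      ∑ (allFin r) (λ _ → s)                          ≡⟨ trans (∑-const (allFin r) s) (cong (_* s) (length-allFin r)) ⟩
      r * s                                           ≤⟨ *-monoˡ-≤ s r≤M ⟩
      M * s                                           ∎
      where
      open ≤-Reasoning
      smallClass : Fin r → Bool
      smallClass i = not ⌊ s <? card (class P i) ⌋
      bound : ∀ i → card (class P i) * ⟦ smallClass i ⟧ ≤ s
      bound i with s <? card (class P i)
      ... | yes _ = ≤-trans (≤-reflexive (*-zeroʳ (card (class P i)))) z≤n
      ... | no  ≮ = ≤-trans (≤-reflexive (*-identityʳ _)) (≮⇒≥ ≮)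

    few-bad : Z * card bad ≤ n
    few-bad = *-cancelˡ-≤ 2 (begin
      2 * (Z * card bad)                       ≡⟨ sym (*-assoc 2 Z _) ⟩
      2 * Z * card bad                         ≤⟨ *-monoʳ-≤ (2 * Z) (≤-trans (∑-mono (allFin n) (λ u → union (heavy u) (small u)))
                                                    (≤-reflexive (∑-+ (allFin n) _ _))) ⟩
      2 * Z * (card heavy + card small)        ≡⟨ *-distribˡ-+ (2 * Z) _ _ ⟩
      2 * Z * card heavy + 2 * Z * card small  ≤⟨ +-mono-≤ few-heavy (≤-trans (*-monoʳ-≤ (2 * Z) few-small) n-large) ⟩
      n + n                                    ≡⟨ cong (n +_) (sym (+-identityʳ n)) ⟩
      2 * n                                    ∎)
      where
      open ≤-Reasoning
      union : ∀ x y → ⟦ x ∨ y ⟧ ≤ ⟦ x ⟧ + ⟦ y ⟧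
      union true  y = m≤m+n 1 ⟦ y ⟧
      union false y = ≤-refl

  -- Rounding a fractional tiling to a list of types.

  ∑-replicate : {A : Set} (m : ℕ) (x : A) (f : A → ℕ) → ∑ (replicate m x) f ≡ m * f x
  ∑-replicate zero    x f = refl
  ∑-replicate (suc m) x f = cong (f x +_) (∑-replicate m x f)

  repeat : {A B : Set} → (A → ℕ) → (A → B) → List A → List B
  repeat N f []       = []
  repeat N f (t ∷ ts) = replicate (N t) (f t) ++ repeat N f ts

  ∑-repeat : {A B : Set} (N : A → ℕ) (f : A → B) (ts : List A) (g : B → ℕ) →
             ∑ (repeat N f ts) g ≡ ∑ ts (λ t → N t * g (f t))
  ∑-repeat N f []       g = refl
  ∑-repeat N f (t ∷ ts) g = trans (∑-++ (replicate (N t) (f t)) _ g)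
    (cong₂ _+_ (∑-replicate (N t) (f t) g) (∑-repeat N f ts g))

  length-∑ : {A : Set} (xs : List A) → length xs ≡ ∑ xs (λ _ → 1)
  length-∑ xs = trans (sym (*-identityʳ (length xs))) (sym (∑-const xs 1))

  -- The condition is demanded only of types that occur, since only those come from a homomorphism.
  All-repeat : {A B : Set} {Q : B → Set} (N : A → ℕ) (f : A → B) (ts : List A) →
               (∀ t → 1 ≤ N t → Q (f t)) → All Q (repeat N f ts)
  All-repeat N f []       q = []
  All-repeat {Q = Q} N f (t ∷ ts) q = ++⁺ (copies (N t) (q t)) (All-repeat N f ts q)
    where
    copies : ∀ m → (1 ≤ m → Q (f t)) → All Q (replicate m (f t))
    copies zero    _ = []
    copies (suc m) h = replicate⁺ (suc m) (h (s≤s z≤n))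

  ⟦⟧-+-not : ∀ b → 1 ≡ ⟦ b ⟧ + ⟦ not b ⟧
  ⟦⟧-+-not true  = refl
  ⟦⟧-+-not false = refl

  module Rounding (k a b : ℕ) {n : ℕ} (G : Graph n) (D E K z M : ℕ)
    (1≤D : 1 ≤ D) (D-large : D ≡ 8 * (suc z * suc z)) (E-large : 2 * (K * K) * vB k a b < E)
    (K-large : suc z * (4 * D) ^ vB k a b ≤ K) (1≤n : 1 ≤ n) (n-large : 2 * suc z * (M * (2 * D * K)) ≤ n)
    (𝒫 : Regularity.Partition (adj G) D E M) where

    open Bottle k a b
    open Regularity.Partition 𝒫
    open Cleaning G D E (suc z) (2 * D * K) M D-large 1≤n n-large 𝒫
    open Tiling G D E K z 1≤D E-large K-large P

    T : ℕ
    T = r ^ order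

    T≤ : T ≤ M ^ order
    T≤ = ^-monoˡ-≤ order r≤M

    colouring : Fin T → B → Fin r
    colouring t x = finToFun t (encode x)

    type : (B → Fin n) → Fin T
    type f = funToFin (P ∘ f ∘ decode)

    colouring-type : ∀ f x → colouring (type f) x ≡ P (f x)
    colouring-type f x = trans (finToFun-funToFin (P ∘ f ∘ decode) (encode x)) (cong (P ∘ f) (decode-encode x))

    load-cong : {c d : B → Fin r} → (∀ x → c x ≡ d x) → ∀ i → load c i ≡ load d i
    load-cong h i = ∑-cong vertices (λ x → cong (λ j → ⟦ ⌊ j Fin.≟ i ⌋ ⟧) (h x))

    module _ (w : List (Hom k a b cleaned × ℕ)) (q : ℕ) (1≤q : 1 ≤ q)
             (capacity : ∀ v → ∑ w (λ (θ , p) → p * preimage θ v) ≤ q) where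

      private
        instance
          q≢0 : NonZero q
          q≢0 = >-nonZero 1≤q
          Zq≢0 : NonZero (suc z * q)
          Zq≢0 = m*n≢0 (suc z) q

      touches : Hom k a b cleaned → Bool
      touches θ = any (bad ∘ hmap θ) vertices

      preimage≡ : ∀ (θ : Hom k a b cleaned) v → preimage θ v ≡ ∑ vertices (λ x → ⟦ ⌊ hmap θ x Fin.≟ v ⌋ ⟧)
      preimage≡ θ v = countL-∑ (λ x → ⌊ hmap θ x Fin.≟ v ⌋) vertices

      ∑-preimage : ∀ (θ : Hom k a b cleaned) (g : Fin n → ℕ) →
                   ∑ (allFin n) (λ v → preimage θ v * g v) ≡ ∑ vertices (g ∘ hmap θ)
      ∑-preimage θ g = trans (∑-cong (allFin n) (λ v → cong (_* g v) (preimage≡ θ v))) (∑-preimages (hmap θ) g)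

      -- The capacity inequality at v is multiplied by g v and summed over v, and the order of
      -- summation is exchanged. It is applied with g the indicator of the bad vertices and with g
      -- the indicator of a class.
      capacity-weighted : ∀ (g : Fin n → ℕ) →
        ∑ w (λ (θ , p) → p * ∑ vertices (g ∘ hmap θ)) ≤ q * ∑ (allFin n) g
      capacity-weighted g = begin
        ∑ w (λ (θ , p) → p * ∑ vertices (g ∘ hmap θ))
          ≡⟨ ∑-cong w (λ (θ , p) → trans (cong (p *_) (sym (∑-preimage θ g)))
               (trans (sym (∑-*ˡ p (allFin n) _)) (∑-cong (allFin n) (λ v → sym (*-assoc p (preimage θ v) (g v)))))) ⟩
        ∑ w (λ (θ , p) → ∑ (allFin n) (λ v → p * preimage θ v * g v))
          ≡⟨ ∑-swap w (allFin n) (λ (θ , p) v → p * preimage θ v * g v) ⟩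
        ∑ (allFin n) (λ v → ∑ w (λ (θ , p) → p * preimage θ v * g v))
          ≤⟨ ∑-mono (allFin n) (λ v → ≤-trans (≤-reflexive (∑-*ʳ (g v) w _)) (*-monoˡ-≤ (g v) (capacity v))) ⟩
        ∑ (allFin n) (λ v → q * g v)
          ≡⟨ ∑-*ˡ q (allFin n) g ⟩
        q * ∑ (allFin n) g ∎
        where open ≤-Reasoning

      mass : Hom k a b cleaned × ℕ → ℕ
      mass (θ , p) = p * ⟦ not (touches θ) ⟧

      -- A homomorphism touching bad vertices hits at least one of them, so the weight thrown away
      -- is at most what the capacities of the bad vertices admit.
      discarded : ∑ w proj₂ ≤ q * card bad + ∑ w mass
      discarded = begin
        ∑ w proj₂                                   ≡⟨ ∑-cong w (λ (θ , p) → trans (sym (*-identityʳ p))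
                                                         (trans (cong (p *_) (⟦⟧-+-not (touches θ))) (*-distribˡ-+ p _ _))) ⟩
        ∑ w (λ (θ , p) → p * ⟦ touches θ ⟧ + p * ⟦ not (touches θ) ⟧) ≡⟨ ∑-+ w _ mass ⟩
        ∑ w (λ (θ , p) → p * ⟦ touches θ ⟧) + ∑ w mass ≤⟨ +-monoˡ-≤ (∑ w mass) (≤-trans
                                                         (∑-mono w (λ (θ , p) → *-monoʳ-≤ p (any≤∑ (bad ∘ hmap θ) vertices)))
                                                         (capacity-weighted (λ v → ⟦ bad v ⟧))) ⟩
        q * card bad + ∑ w mass ∎
        where open ≤-Reasoning

      ofType : Fin T → Hom k a b cleaned × ℕ → ℕ
      ofType t (θ , p) = ⟦ ⌊ type (hmap θ) Fin.≟ t ⌋ ⟧ * mass (θ , p)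

      typeMass : Fin T → ℕ
      typeMass t = ∑ w (ofType t)

      ∑-typeMass : ∀ (g : Fin T → ℕ) →
        ∑ (allFin T) (λ t → typeMass t * g t) ≡ ∑ w (λ θp → mass θp * g (type (hmap (proj₁ θp))))
      ∑-typeMass g = trans (∑-cong (allFin T) (λ t → sym (∑-*ʳ (g t) w (ofType t))))
        (trans (∑-swap (allFin T) w (λ t θp → ofType t θp * g t))
          (∑-cong w (λ θp → trans (∑-cong (allFin T) (λ t → *-assoc ⟦ ⌊ type (hmap (proj₁ θp)) Fin.≟ t ⌋ ⟧ (mass θp) (g t)))
            (∑-δ (type (hmap (proj₁ θp))) (λ t → mass θp * g t)))))

      -- `typeMass t` over q is the fractional number of copies of type t. It is scaled by z/Z,
      -- which leaves the share 1/Z of each class that `realise` needs, and then rounded down.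
      multiplicity : Fin T → ℕ
      multiplicity t = z * typeMass t / (suc z * q)

      schedule : List (B → Fin r)
      schedule = repeat multiplicity colouring (allFin T)

      -- Rounding down only lowers the load. Before rounding, the load on class i is z/Z times a
      -- weight that the capacities of its vertices bound by |Pᵢ|.
      within-budget : ∀ i → suc z * ∑ schedule (λ c → load c i) ≤ z * card (class P i)
      within-budget i = *-cancelʳ-≤ _ _ q (begin
        suc z * ∑ schedule (λ c → load c i) * q
          ≡⟨ cong (λ s → suc z * s * q) (∑-repeat multiplicity colouring (allFin T) (λ c → load c i)) ⟩
        suc z * ∑ (allFin T) (λ t → multiplicity t * ℓ t) * q
          ≡⟨ trans (rotate (suc z) _ q) (sym (∑-*ˡ (suc z * q) (allFin T) _)) ⟩
        ∑ (allFin T) (λ t → suc z * q * (multiplicity t * ℓ t))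
          ≤⟨ ∑-mono (allFin T) (λ t → ≤-trans (≤-reflexive (swap (suc z * q) (multiplicity t) (ℓ t)))
               (≤-trans (*-monoˡ-≤ (ℓ t) (m/n*n≤m (z * typeMass t) (suc z * q))) (≤-reflexive (*-assoc z (typeMass t) (ℓ t))))) ⟩
        ∑ (allFin T) (λ t → z * (typeMass t * ℓ t))
          ≡⟨ trans (∑-*ˡ z (allFin T) _) (cong (z *_) (∑-typeMass ℓ)) ⟩
        z * ∑ w (λ θp → mass θp * ℓ (type (hmap (proj₁ θp))))
          ≤⟨ *-monoʳ-≤ z (∑-mono w (λ (θ , p) → *-mono-≤
               (≤-trans (*-monoʳ-≤ p (⟦⟧≤1 (not (touches θ)))) (≤-reflexive (*-identityʳ p)))
               (≤-reflexive (load-cong (colouring-type (hmap θ)) i)))) ⟩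
        z * ∑ w (λ (θ , p) → p * load (P ∘ hmap θ) i)
          ≤⟨ *-monoʳ-≤ z (capacity-weighted (λ v → ⟦ class P i v ⟧)) ⟩
        z * (q * card (class P i))
          ≡⟨ trans (cong (z *_) (*-comm q _)) (sym (*-assoc z _ q)) ⟩
        z * card (class P i) * q ∎)
        where
        open ≤-Reasoning
        ℓ : Fin T → ℕ
        ℓ t = load (colouring t) i
        rotate : ∀ x y w → x * y * w ≡ x * w * y
        rotate = solve-∀
        swap : ∀ x y w → x * (y * w) ≡ y * x * w
        swap = solve-∀

      -- Each of the T types loses less than one copy to the floor, which amounts to Z q after
      -- clearing denominators.
      rounding-loss : z * ∑ w mass ≤ suc z * q * length schedule + suc z * q * T
      rounding-loss = begin
        z * ∑ w mass
          ≡⟨ cong (z *_) (trans (∑-cong w (λ θp → sym (*-identityʳ (mass θp)))) (sym (∑-typeMass (λ _ → 1)))) ⟩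
        z * ∑ (allFin T) (λ t → typeMass t * 1)
          ≡⟨ trans (sym (∑-*ˡ z (allFin T) _)) (∑-cong (allFin T) (λ t → cong (z *_) (*-identityʳ (typeMass t)))) ⟩
        ∑ (allFin T) (λ t → z * typeMass t)
          ≤⟨ ∑-mono (allFin T) (λ t → ≤-trans (≤-reflexive (m≡m%n+[m/n]*n (z * typeMass t) Zq))
               (≤-trans (+-monoˡ-≤ _ (<⇒≤ (m%n<n (z * typeMass t) Zq)))
                 (≤-reflexive (trans (+-comm Zq _) (cong₂ _+_ (*-comm (multiplicity t) Zq) (sym (*-identityʳ Zq))))))) ⟩
        ∑ (allFin T) (λ t → Zq * multiplicity t + Zq * 1)
          ≡⟨ trans (∑-+ (allFin T) _ _) (cong₂ _+_ (∑-*ˡ Zq (allFin T) _) (∑-*ˡ Zq (allFin T) _)) ⟩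
        Zq * ∑ (allFin T) multiplicity + Zq * ∑ (allFin T) (λ _ → 1)
          ≡⟨ cong₂ (λ x y → Zq * x + Zq * y)
               (sym (trans (length-∑ schedule) (trans (∑-repeat multiplicity colouring (allFin T) (λ _ → 1))
                 (∑-cong (allFin T) (λ t → *-identityʳ (multiplicity t))))))
               (trans (sym (length-∑ (allFin T))) (length-allFin T)) ⟩
        Zq * length schedule + Zq * T ∎
        where
        open ≤-Reasoning
        Zq = suc z * q

      -- A type of positive multiplicity has positive mass, hence is the type of a homomorphism into
      -- the cleaned graph that avoids bad vertices. Its image vertices certify that the classes are
      -- large and that the pairs needed are lower-regular.
      schedule-admissible : All Admissible schedule
      schedule-admissible = All-repeat multiplicity colouring (allFin T) admissible
        where
        positive-mass : ∀ t → 1 ≤ multiplicity t → 1 ≤ typeMass t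
        positive-mass t 1≤N with typeMass t
        ... | suc _ = s≤s z≤n
        ... | zero  = ⊥-elim (<⇒≱ 1≤N (≤-reflexive (trans (cong (λ x → x / (suc z * q)) (*-zeroʳ z)) (0/n≡0 (suc z * q)))))
        witness : ∀ t → 1 ≤ typeMass t → ∃ λ (θ : Hom k a b cleaned) → (type (hmap θ) ≡ t) × (touches θ ≡ false)
        witness t 1≤W with ∑-<⇒∃ w (λ _ → 0) (ofType t) (≤-trans (≤-reflexive (cong suc (∑-zero w))) 1≤W)
        ... | (θ , p) , pos = θ , split (type (hmap θ) Fin.≟ t) (touches θ) pos
          where
          split : ∀ (d : Dec (type (hmap θ) ≡ t)) c → 0 < ⟦ ⌊ d ⌋ ⟧ * (p * ⟦ not c ⟧) → (type (hmap θ) ≡ t) × (c ≡ false)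
          split (yes eq) false _  = eq , refl
          split (yes eq) true  lt = ⊥-elim (<⇒≱ lt (≤-reflexive (trans (+-identityʳ (p * 0)) (*-zeroʳ p))))
        admissible : ∀ t → 1 ≤ multiplicity t → Admissible (colouring t)
        admissible t 1≤N with witness t (positive-mass t 1≤N)
        ... | θ , refl , avoids = record
          { class-large = λ x → subst (λ i → 2 * D * K < card (class P i)) (sym (colouring-type (hmap θ) x))
                                  (not-bad⇒large (hmap θ x) (good x))
          ; regular = λ x y x~y → subst₂ (LowerRegular G D E P) (sym (colouring-type (hmap θ) x)) (sym (colouring-type (hmap θ) y))
                                    (cleaned⇒regular (hmap θ x) (hmap θ y) (pres θ x y x~y) (good x) (good y))
          }
          where
          good : ∀ x → bad (hmap θ x) ≡ false
          good x with bad (hmap θ x) in eq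
          ... | false = refl
          ... | true  = trans (sym (any⁺ (bad ∘ hmap θ) (∈-vertices x) eq)) avoids

      realisation : Realisation schedule
      realisation = realise schedule schedule-admissible within-budget

  -- Final accounting and choice of constants.

  -- The deficit n - c is at most (3 + h) n/Z = n/s. Here p and p′ are the weights before and after
  -- discarding, β counts the bad vertices, N the copies placed and T the types; the summands are
  -- n/Z for the defect of the fractional tiling, h n/Z for bad vertices, n/Z for the factor z/Z and
  -- n/Z for rounding.
  coverage : ∀ h s z n q β p p′ N T c → suc z ≡ (3 + h) * s → 1 ≤ q →
    suc z * (n * q) ≤ suc z * (h * p) + n * q → p ≤ q * β + p′ → suc z * β ≤ n →
    z * p′ ≤ suc z * q * N + suc z * q * T → suc z * h * T ≤ n → h * N ≤ c →
    s * n ≤ s * c + n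
  coverage h s z n q β p p′ N T c Z≡ 1≤q weight kept few-bad rounded few-types hN≤c =
    *-cancelˡ-≤ (3 + h) (begin
      (3 + h) * (s * n)                 ≡⟨ trans (sym (*-assoc (3 + h) s n)) (cong (_* n) (sym Z≡)) ⟩
      Z * n                             ≤⟨ *-cancelˡ-≤ Z multiplied ⟩
      Z * h * T + ((2 + h) * n + Z * (h * N)) ≤⟨ +-mono-≤ few-types (+-monoʳ-≤ ((2 + h) * n) (*-monoʳ-≤ Z hN≤c)) ⟩
      n + ((2 + h) * n + Z * c)         ≡⟨ cong (λ Z → n + ((2 + h) * n + Z * c)) Z≡ ⟩
      n + ((2 + h) * n + (3 + h) * s * c) ≡⟨ last h s n c ⟩
      (3 + h) * (s * c + n)             ∎)
    where
    open ≤-Reasoning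
    instance _ = >-nonZero 1≤q
    Z = suc z
    last : ∀ h s n c → n + ((2 + h) * n + (3 + h) * s * c) ≡ (3 + h) * (s * c + n)
    last = solve-∀
    -- The weight inequality is multiplied by z because `rounded` controls z p′ rather than p′.
    first : z * Z * n ≤ z * ((1 + h) * n) + Z * h * (Z * N + Z * T)
    first = *-cancelʳ-≤ _ _ q (begin
      z * Z * n * q                              ≡⟨ e₁ z Z n q ⟩
      z * (Z * (n * q))                          ≤⟨ *-monoʳ-≤ z (≤-trans weight (+-monoˡ-≤ (n * q) (*-monoʳ-≤ Z (*-monoʳ-≤ h kept)))) ⟩
      z * (Z * (h * (q * β + p′)) + n * q)       ≡⟨ e₂ z Z h q β p′ n ⟩
      z * (h * q * (Z * β) + n * q) + Z * h * (z * p′)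
        ≤⟨ +-mono-≤ (*-monoʳ-≤ z (+-monoˡ-≤ (n * q) (*-monoʳ-≤ (h * q) few-bad))) (*-monoʳ-≤ (Z * h) rounded) ⟩
      z * (h * q * n + n * q) + Z * h * (Z * q * N + Z * q * T) ≡⟨ e₃ z Z h q n N T ⟩
      (z * ((1 + h) * n) + Z * h * (Z * N + Z * T)) * q ∎)
      where
      e₁ : ∀ z Z n q → z * Z * n * q ≡ z * (Z * (n * q))
      e₁ = solve-∀
      e₂ : ∀ z Z h q β p′ n → z * (Z * (h * (q * β + p′)) + n * q) ≡ z * (h * q * (Z * β) + n * q) + Z * h * (z * p′)
      e₂ = solve-∀
      e₃ : ∀ z Z h q n N T → z * (h * q * n + n * q) + Z * h * (Z * q * N + Z * q * T) ≡
                             (z * ((1 + h) * n) + Z * h * (Z * N + Z * T)) * q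
      e₃ = solve-∀
    -- Adding Z n completes z Z n to Z² n, so that a factor Z cancels. This summand is the price of
    -- the scaling by z/Z.
    multiplied : Z * (Z * n) ≤ Z * (Z * h * T + ((2 + h) * n + Z * (h * N)))
    multiplied = begin
      Z * (Z * n)                                ≡⟨ cong (Z * n +_) (sym (*-assoc z Z n)) ⟩
      Z * n + z * Z * n                          ≤⟨ +-monoʳ-≤ (Z * n) (≤-trans first (+-monoˡ-≤ _ (*-monoˡ-≤ ((1 + h) * n) (n≤1+n z)))) ⟩
      Z * n + (Z * ((1 + h) * n) + Z * h * (Z * N + Z * T)) ≡⟨ e₄ Z h n N T ⟩
      Z * (Z * h * T + ((2 + h) * n + Z * (h * N))) ∎
      where
      e₄ : ∀ Z h n N T → Z * n + (Z * ((1 + h) * n) + Z * h * (Z * N + Z * T)) ≡ Z * (Z * h * T + ((2 + h) * n + Z * (h * N)))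
      e₄ = solve-∀

  module Constants (k a b : ℕ) (μ ρ′ : ℚ) (s z : ℕ) (Z≡ : suc z ≡ (3 + vB k a b) * s)
    (1≤s : 1 ≤ s) (s-large : 1ℚ ℚ.≤ ρ′ ℚ.* ℕ→ℚ s) (Z-large : 1ℚ ℚ.≤ μ ℚ.* ℕ→ℚ (suc z))
    (D E K M : ℕ) (1≤D : 1 ≤ D) (D≤E : D ≤ E) (D≡ : D ≡ 8 * (suc z * suc z))
    (E-large : 2 * (K * K) * vB k a b < E) (K-large : suc z * (4 * D) ^ vB k a b ≤ K)
    (M≡ : M ≡ partsBound (suc (E * E)) 1) where

    module Assembly (ρ : ℚ) (ρ-small : ρ ℚ.* ℕ→ℚ (suc z) ℚ.≤ 1ℚ) {n : ℕ} (1≤n : 1 ≤ n)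
      (n-large : 2 * suc z * (M * (2 * D * K)) ≤ n) (n-large′ : suc z * vB k a b * M ^ vB k a b ≤ n)
      (G : Graph n) where

      𝒫 : Regularity.Partition (adj G) D E M
      𝒫 = subst (Regularity.Partition (adj G) D E) (sym M≡) (Regularity.regularity (adj G) D E D≤E)

      open Rounding k a b G D E K z M 1≤D D≡ E-large K-large 1≤n n-large 𝒫
      open Cleaning G D E (suc z) (2 * D * K) M D≡ 1≤n n-large 𝒫
      open Regularity.Partition 𝒫 using (r; P)
      open Bottle k a b using (order)
      open Bottle.Tiling k a b G D E K z 1≤D E-large K-large P using (Realisation)

      -- All vertices are kept, so the size condition is immediate; the degree condition is `degree`
      -- together with 1/Z ≤ μ.
      approximation : Approximation G μ μ
      approximation = record
        { m = n ; H = cleaned ; ι = id ; ι-inj = id ; sub = cleaned⊆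
        ; degOK  = λ v → ≤-from-multiple μ (suc z) (deg G v) (deg cleaned v) n (s≤s z≤n) Z-large (degree v)
        ; sizeOK = ℚ.≤-trans (ℚ.≤-reflexive ([1-p]n≡n-pn μ (ℕ→ℚ n)))
                     (≤-from-multiple μ (suc z) n n n (s≤s z≤n) Z-large (m≤m+n _ n))
        }

      Conclusion : Set
      Conclusion =
        Σ (List (Copy k a b G)) λ L → IsTiling k a b G L × ((1ℚ ℚ.- ρ′) ℚ.* ℕ→ℚ n ℚ.≤ ℕ→ℚ (coveredCount L))

      tiling-from-ℕ : (q : ℕ) (w : List (Hom k a b cleaned × ℕ)) → 1 ≤ q →
        (∀ v → ∑ w (λ (θ , p) → p * preimage θ v) ≤ q) →
        suc z * (n * q) ≤ suc z * (order * ∑ w proj₂) + n * q → Conclusion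
      tiling-from-ℕ q w 1≤q capacity weight = tiles , isTiling , ℚ.≤-trans (ℚ.≤-reflexive ([1-p]n≡n-pn ρ′ (ℕ→ℚ n)))
        (≤-from-multiple ρ′ s n (coveredCount tiles) n 1≤s s-large
          (coverage order s z n q (card bad) (∑ w proj₂) (∑ w (mass w q 1≤q capacity)) (length (schedule w q 1≤q capacity)) T
            (coveredCount tiles) Z≡ 1≤q weight (discarded w q 1≤q capacity) few-bad (rounding-loss w q 1≤q capacity)
            (≤-trans (*-monoʳ-≤ (suc z * order) T≤) n-large′)
            (≤-trans covering (≤-reflexive (sym (countL-∑ (covers tiles) (allFin n)))))))
        where open Realisation (realisation w q 1≤q capacity)

      tiling : PerfectFracTiling k a b ρ cleaned → Conclusion
      tiling (L , (bounds , capacity) , weight) = round (common-denominator L (All.map proj₁ bounds))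
        where
        round : Cleared L → Conclusion
        round C = tiling-from-ℕ q w 1≤q capacityℕ
          (weight-in-ℕ ρ z n order (∑ w proj₂) q (sumℚ (map proj₂ L)) 1≤q ρ-small total weight)
          where
          open Cleared C renaming (denominator to q; numerators to w; denominator-positive to 1≤q; equal to S≡)
          capacityℕ : ∀ v → ∑ w (λ (θ , p) → p * preimage θ v) ≤ q
          capacityℕ v = ℕ→ℚ-cancel {∑ w (λ (θ , p) → p * preimage θ v)} {q} (ℚ.≤-trans (ℚ.≤-reflexive (sym (S≡ (λ θ → preimage θ v))))
            (ℚ.≤-trans (ℚ.*-monoʳ-≤-nonNeg (ℕ→ℚ q) {{ℕ→ℚ-nonNeg q}} (capacity v)) (ℚ.≤-reflexive (ℚ.*-identityˡ (ℕ→ℚ q)))))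
          total : sumℚ (map proj₂ L) ℚ.* ℕ→ℚ q ≡ ℕ→ℚ (∑ w proj₂)
          total = trans (cong (λ l → sumℚ l ℚ.* ℕ→ℚ q) (map-cong (λ p → sym (ℚ.*-identityʳ (proj₂ p))) L))
            (trans (S≡ (λ _ → 1)) (cong ℕ→ℚ (∑-cong w (λ p → *-identityʳ (proj₂ p)))))

    -- The first summand makes the vertices in small classes few, the second makes the loss from
    -- rounding at most n/Z, and the successor ensures 1 ≤ n.
    n₀ : ℕ
    n₀ = suc (2 * suc z * (M * (2 * D * K)) + suc z * vB k a b * M ^ vB k a b)

    robust⇒tiling : ∀ ρ → ρ ℚ.* ℕ→ℚ (suc z) ℚ.≤ 1ℚ → (n : ℕ) → n ≥ n₀ → (ℓ t : ℕ) (G : Graph n) →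
      RobustTilingFramework μ k a b ρ t ℓ G →
      Σ (List (Copy k a b G)) λ L → IsTiling k a b G L × ((1ℚ ℚ.- ρ′) ℚ.* ℕ→ℚ n ℚ.≤ ℕ→ℚ (coveredCount L))
    robust⇒tiling ρ ρ-small n n≥n₀ ℓ t G framework = tiling (proj₁ (framework approximation))
      where
      open Assembly ρ ρ-small {n} (≤-trans (s≤s z≤n) n≥n₀)
        (≤-trans (≤-trans (m≤m+n _ _) (n≤1+n _)) n≥n₀)
        (≤-trans (≤-trans (m≤n+m _ (2 * suc z * (M * (2 * D * K)))) (n≤1+n _)) n≥n₀) G

  almost-perfect-tiling : (k a b : ℕ) (μ ρ′ : ℚ) → 0ℚ ℚ.< μ → 0ℚ ℚ.< ρ′ →
    ∃ λ ρ₀ → (0ℚ ℚ.< ρ₀) × (∀ ρ → ρ ℚ.≤ ρ₀ → ∃ λ n₀ → (n : ℕ) → n ≥ n₀ → (ℓ t : ℕ) (G : Graph n) →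
      RobustTilingFramework μ k a b ρ t ℓ G →
      Σ (List (Copy k a b G)) λ L → IsTiling k a b G L × ((1ℚ ℚ.- ρ′) ℚ.* ℕ→ℚ n ℚ.≤ ℕ→ℚ (coveredCount L)))
  almost-perfect-tiling k a b μ ρ′ 0<μ 0<ρ′ =
    1/ℚ z , 1/ℚ-pos z , λ ρ ρ≤ρ₀ → n₀ , robust⇒tiling ρ (≤1/ℚ⇒*≤1 ρ z ρ≤ρ₀)
    where
    scale-up : ∀ p Q Q′ → 0ℚ ℚ.< p → Q ≤ Q′ → 1ℚ ℚ.≤ p ℚ.* ℕ→ℚ Q → 1ℚ ℚ.≤ p ℚ.* ℕ→ℚ Q′
    scale-up p Q Q′ 0<p Q≤Q′ le =
      ℚ.≤-trans le (ℚ.*-monoˡ-≤-nonNeg p {{ℚ.nonNegative (ℚ.<⇒≤ 0<p)}} (ℕ→ℚ-mono {Q} {Q′} Q≤Q′))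
    arch-ρ′ = archimedean ρ′ 0<ρ′
    arch-μ  = archimedean μ 0<μ
    h  = vB k a b
    Q₁ = proj₁ arch-ρ′
    Q₂ = proj₁ arch-μ
    -- The role of s is played by `suc q₀`, which exceeds both Archimedean bounds. The form of z
    -- makes `suc z` compute to (3 + h) * `suc q₀`, so that equation holds by `refl`.
    q₀ = Q₁ + Q₂
    z  = q₀ + (2 + h) * suc q₀
    D  = 8 * (suc z * suc z)
    K  = suc z * (4 * D) ^ h
    -- The summand D yields D ≤ E, and the successor makes E > 2 K² h strict.
    E  = suc (2 * (K * K) * h + D)
    open Constants k a b μ ρ′ (suc q₀) z refl (s≤s z≤n)
      (scale-up ρ′ Q₁ (suc q₀) 0<ρ′ (≤-trans (m≤m+n Q₁ Q₂) (n≤1+n q₀)) (proj₂ (proj₂ arch-ρ′)))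
      (scale-up μ Q₂ (suc z) 0<μ (≤-trans (≤-trans (m≤n+m Q₂ Q₁) (n≤1+n q₀)) (m≤m+n (suc q₀) _)) (proj₂ (proj₂ arch-μ)))
      D E K (partsBound (suc (E * E)) 1) (s≤s z≤n) (≤-trans (m≤n+m D _) (n≤1+n _)) refl (s≤s (m≤m+n _ D)) ≤-refl refl

open import Data.Nat using (ℕ; _≤_; _≥_)
open import Data.Nat.Coprimality using (Coprime)
open import Data.Rational using (ℚ; 0ℚ; 1ℚ; _<_; _-_; _*_) renaming (_≤_ to _≤ℚ_)

theorem9p1 : (k a b : ℕ) → 1 ≤ k → 1 ≤ a → a ≤ b → Coprime a b →
    (μ : ℚ) → 0ℚ < μ → μ ≤ℚ 1ℚ →
    Σ ℚ λ ρ'₀ → 0ℚ < ρ'₀ ×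
    ((ρ' : ℚ) → 0ℚ < ρ' → ρ' ≤ℚ ρ'₀ →
    Σ ℚ λ ρ₀ → 0ℚ < ρ₀ ×
    ((ρ : ℚ) → 0ℚ < ρ → ρ ≤ℚ ρ₀ →
    Σ ℕ λ n₀ → (n : ℕ) → n ≥ n₀ → (ℓ t : ℕ) → (G : Graph n) →
    RobustTilingFramework μ k a b ρ t ℓ G →
    Σ (List (Copy k a b G)) λ L →
    IsTiling k a b G L × ((1ℚ - ρ') * ℕ→ℚ n ≤ℚ ℕ→ℚ (coveredCount L))))
-- The value 1 serves as ρ'₀; it computes to `1/ℚ 0`, whence its positivity.
theorem9p1 k a b _ _ _ _ μ 0<μ _ = 1ℚ , Rationals.1/ℚ-pos 0 , λ ρ' 0<ρ' _ →
  let ρ₀ , 0<ρ₀ , tile = Tilings.almost-perfect-tiling k a b μ ρ' 0<μ 0<ρ'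
  in  ρ₀ , 0<ρ₀ , λ ρ _ → tile ρ
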